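{- Let $m,n$ be two positive integers with $m=O(n^{\alpha})$ (i.e., $m\leq Cn^{\alpha}$ for some positive constant $C$), where $\alpha\in\mathbb{R}$ and $\alpha\geq 1$. For every pair of positive integers $k,\ell$ with $k\geq 3$, there exists a positive integer $N=N(k,\ell)$ such that $$rx_{k,\ell}(K_{m,n})=\begin{cases}3 & \text{if } k=3 \text{ and } \ell=1,2,\\ 4 & \text{if } k=3 \text{ and } \ell\geq 3,\\ k+1 & \text{if } k\geq 4\end{cases}$$ for every integer $n\geq N$.
   Context: All graphs are undirected, finite and simple. $K_{m,n}$ is the complete bipartite graph with vertex classes of sizes $m$ and $n$. An edge-coloring of a graph $G$ with $t$ colors is any map $c:E(G)\to\{1,\dots,t\}$ (adjacent edges may receive the same color). A tree $T$ in $G$ is a rainbow tree if no two edges of $T$ have the same color. For $S\subseteq V(G)$, an $S$-tree is a tree in $G$ connecting the vertices of $S$ (that is, containing all of them), and a rainbow $S$-tree is an $S$-tree that is a rainbow tree. Rainbow $S$-trees $T_1,\dots,T_\ell$ are internally disjoint if $E(T_i)\cap E(T_j)=\emptyset$ and $V(T_i)\cap V(T_j)=S$ for every pair of distinct integers $i,j$ with $1\le i,j\le \ell$. The $(k,\ell)$-rainbow index $rx_{k,\ell}(G)$ is the minimum number of colors needed in an edge-coloring of $G$ such that for every set $S$ of $k$ vertices of $G$ there exist $\ell$ internally disjoint rainbow $S$-trees.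
   Formalization: The formal theorem adds n ≤ m, i.e. m is the larger class: as literally stated the claim fails for m = 1, where K_{1,n} is a star with rx_{3,1} = n. The threshold N depends on the fixed C and α as well as on k and ℓ. -}

module Defs where

open import Data.Bool using (Bool; false; true; T; _xor_)
open import Data.Bool.Properties using (xor-comm; xor-same)
open import Data.Fin using (Fin; zero; suc; toℕ; inject₁; fromℕ)
open import Data.Fin.Subset using (Subset; _∈_; _⊆_; _∩_; ∣_∣; Nonempty)
open import Data.Integer using (+_)
open import Data.Nat using (ℕ; _+_; _*_; _^_; _≤_; _<?_; NonZero)
open import Data.Product using (Σ; ∃; ∃-syntax; _×_; _,_)
open import Data.Rational using (ℚ; _/_) renaming (_<_ to _<ℚ_)
open import Data.Sum using (_⊎_)
open import Function.Bundles using (_⇔_)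
open import Function.Definitions using (Injective)
open import Relation.Binary.Construct.Closure.ReflexiveTransitive using (Star)
open import Relation.Binary.PropositionalEquality using (_≡_; _≢_)
open import Relation.Nullary using (¬_)
open import Relation.Nullary.Decidable using (⌊_⌋)

-- Two-sided Dedekind cuts.
record ℝ : Set₁ where
  field
    L U         : ℚ → Set
    L-inhabited : ∃[ q ] L q
    U-inhabited : ∃[ q ] U q
    L-rounded   : ∀ q → L q ⇔ (∃[ r ] (q <ℚ r × L r))
    U-rounded   : ∀ q → U q ⇔ (∃[ r ] (r <ℚ q × U r))
    disjoint    : ∀ q → ¬ (L q × U q)
    located     : ∀ q r → q <ℚ r → L q ⊎ U r

infix 4 _ℚ<ℝ_ _ℝ<ℚ_ _ℚ≤ℝ_

_ℚ<ℝ_ : ℚ → ℝ → Set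
q ℚ<ℝ x = ℝ.L x q

_ℝ<ℚ_ : ℝ → ℚ → Set
x ℝ<ℚ q = ℝ.U x q

_ℚ≤ℝ_ : ℚ → ℝ → Set
q ℚ≤ℝ x = ¬ (x ℝ<ℚ q)

-- m ≤ C · n ^ α for natural m, natural n ≥ 1 and real C, α ≥ 0.  In this
-- range C · n ^ α is the infimum of (a / b) · n ^ (p / q) over all rationals
-- a / b > C and p / q > α, and m ≤ (a / b) · n ^ (p / q) is written after
-- multiplying by b and taking q-th powers.
_≤_·_^ℝ_ : ℕ → ℝ → ℕ → ℝ → Set
m ≤ C · n ^ℝ α =
  ∀ (a b p q : ℕ) .{{_ : NonZero b}} .{{_ : NonZero q}} →
  C ℝ<ℚ (+ a / b) → α ℝ<ℚ (+ p / q) →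
  (b * m) ^ q ≤ a ^ q * n ^ p

record Graph : Set where
  field
    order      : ℕ
    adj        : Fin order → Fin order → Bool
    adj-sym    : ∀ u v → adj u v ≡ adj v u
    adj-irrefl : ∀ v → adj v v ≡ false

  Vertex : Set
  Vertex = Fin order

  _~_ : Vertex → Vertex → Set
  u ~ v = T (adj u v)

open Graph using (order; Vertex)

-- The first m of the m + n vertices form one class, the last n the other.
K : ℕ → ℕ → Graph
K m n = record
  { order      = m + n
  ; adj        = λ u v → inFirst u xor inFirst v
  ; adj-sym    = λ u v → xor-comm (inFirst u) (inFirst v)
  ; adj-irrefl = λ v → xor-same (inFirst v)
  }
  where
  inFirst : Fin (m + n) → Bool
  inFirst v = ⌊ toℕ v <? m ⌋

module _ (G : Graph) where
  open Graph G using (_~_)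

  -- colour-sym makes the colour depend only on the unordered edge.
  record EdgeColouring (t : ℕ) : Set where
    field
      colour     : ∀ {u v} → u ~ v → Fin t
      colour-sym : ∀ {u v} (e : u ~ v) (e′ : v ~ u) → colour e ≡ colour e′

  record Subgraph : Set where
    field
      V     : Subset (order G)
      edge  : Vertex G → Vertex G → Bool

    E : Vertex G → Vertex G → Set
    E u v = T (edge u v)

    field
      E-sym : ∀ {u v} → E u v → E v u
      E⇒~   : ∀ {u v} → E u v → u ~ v
      E⇒∈V  : ∀ {u v} → E u v → u ∈ V

module _ {G : Graph} where
  open Subgraph

  Connected : Subgraph G → Set
  Connected H = ∀ {u v} → u ∈ V H → v ∈ V H → Star (E H) u v

  record Cycle (H : Subgraph G) : Set where
    field
      r         : ℕ
      at        : Fin (3 + r) → Vertex G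
      injective : Injective _≡_ _≡_ at
      step      : ∀ (i : Fin (2 + r)) → E H (at (inject₁ i)) (at (suc i))
      close     : E H (at (fromℕ (2 + r))) (at zero)

  IsTree : Subgraph G → Set
  IsTree H = Nonempty (V H) × Connected H × ¬ Cycle H

  IsRainbow : ∀ {t} → EdgeColouring G t → Subgraph G → Set
  IsRainbow c H =
    ∀ {u v x y} (e : E H u v) (f : E H x y) →
    colour (E⇒~ H e) ≡ colour (E⇒~ H f) →
    (u ≡ x × v ≡ y) ⊎ (u ≡ y × v ≡ x)
    where open EdgeColouring c

  IsRainbowTreeConnecting : ∀ {t} → EdgeColouring G t → Subset (order G) → Subgraph G → Set
  IsRainbowTreeConnecting c S H = IsTree H × S ⊆ V H × IsRainbow c H

  InternallyDisjoint : ∀ {ℓ} → Subset (order G) → (Fin ℓ → Subgraph G) → Set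
  InternallyDisjoint S Ts =
    ∀ i j → i ≢ j →
    (∀ u v → ¬ (E (Ts i) u v × E (Ts j) u v)) × V (Ts i) ∩ V (Ts j) ≡ S

  IsRainbowColouring : ∀ {t} → ℕ → ℕ → EdgeColouring G t → Set
  IsRainbowColouring k ℓ c =
    ∀ (S : Subset (order G)) → ∣ S ∣ ≡ k →
    Σ (Fin ℓ → Subgraph G) λ Ts →
      (∀ i → IsRainbowTreeConnecting c S (Ts i)) × InternallyDisjoint S Ts

-- The minimum is a relation because a graph may admit no suitable colouring
-- with any number of colours.
rx[_,_]_is_ : ℕ → ℕ → Graph → ℕ → Set
rx[ k , ℓ ] G is t =
  Admits t × (∀ t′ → Admits t′ → t ≤ t′)
  where
  Admits : ℕ → Set
  Admits t = Σ (EdgeColouring G t) (IsRainbowColouring k ℓ)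

{-# OPTIONS --safe #-}
module Submission where

-- Lower bounds: a connected rainbow subgraph with t colours has at most t + 1 vertices, so for
-- t ≤ k a rainbow S-tree has at most one vertex outside S.  For k ≥ 4 let S span a monochromatic
-- K_{2,k-2}: two terminals on each side would need a neighbour outside S, one on either side.
-- For k = 3 and S = {p, q, v} with p, q opposite v, every tree uses one of the edges vp, vq.
--
-- Upper bounds: it suffices to colour K_{m,n} so that for any few vertices on one side and any
-- prescribed colours for them, many vertices on the other side see exactly these colours.  Such a
-- colouring is explicit.  Give the vertices distinct binary names of length D = O(log n); every
-- vertex also carries a code listing boundedly many positions and a table, and assigns to a
-- vertex opposite the table entry of that vertex's bits at the listed positions.  Boundedly many
-- vertices are separated by boundedly many positions, and there are only polylog(n) codes, so all
-- of them occur on both sides.  S-trees then arise by joining S to one or two new vertices.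

open import Data.Bool using (Bool; true; false; T; not; if_then_else_; _xor_)
open import Data.Bool.Properties using (not-¬; ¬-not; not-involutive; T-irrelevant; T?) renaming (_≟_ to _≟ᵇ_)
open import Data.Empty using (⊥; ⊥-elim)
open import Data.Fin
  using (Fin; zero; suc; toℕ; fromℕ; fromℕ<; inject₁; inject≤; _≟_; splitAt; _↑ˡ_; _↑ʳ_;
         combine; remQuot; finToFun; funToFin)
open import Data.Fin.Properties
  using (any?; all?; pigeonhole; ¬∀⟶∃¬; suc-injective; <⇒≢; *↔×; toℕ-injective; toℕ<n; toℕ-fromℕ;
         toℕ-fromℕ<; toℕ-inject≤; inject≤-injective; toℕ-↑ˡ; toℕ-↑ʳ; ↑ˡ-injective; ↑ʳ-injective;
         splitAt-↑ˡ; splitAt-↑ʳ; remQuot-combine; combine-injectiveˡ; combine-injectiveʳ;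
         finToFun-funToFin; funToFin-finToFin)
open import Data.Fin.Subset
  using (Subset; _∈_; _∉_; _⊆_; _∪_; ⁅_⁆; ∣_∣; inside; outside) renaming (⊥ to ∅)
open import Data.Fin.Subset.Properties
  using (_∈?_; x∈p∪q⁺; x∈p∪q⁻; x∈p∩q⁺; x∈p∩q⁻; x∈⁅x⁆; x∈⁅y⁆⇒x≡y; ⊆-antisym; ∪-identityˡ;
         ∣p∣≤n; p⊆q⇒∣p∣≤∣q∣; ∣⊥∣≡0; ∉⊥; ∣⁅x⁆∣≡1)
open import Data.Integer using (+_; -[1+_])
open import Data.List using (List; []; _∷_; length; filter; take; map; allFin)
open import Data.List.Membership.Propositional using () renaming (_∈_ to _∈ˡ_)
open import Data.List.Membership.Propositional.Properties using (∈-map⁻)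
open import Data.List.Properties using (length-take; length-tabulate; length-map)
open import Data.List.Relation.Unary.All as All using (All; []; _∷_)
import Data.List.Relation.Unary.All.Properties as Allₚ
open import Data.List.Relation.Unary.AllPairs using ([]; _∷_)
import Data.List.Relation.Unary.Any as Any
open import Data.List.Relation.Unary.Unique.Propositional using (Unique)
import Data.List.Relation.Unary.Unique.Propositional.Properties as Uniqueₚ
open import Data.Nat using (ℕ; zero; suc; _+_; _*_; _^_; _≤_; _<_; _≤?_; _<?_; z≤n; s≤s; NonZero)
import Data.Nat as ℕ
open import Data.Nat.DivMod using (_mod_; m<n⇒m%n≡m)
open import Data.Nat.Properties hiding (_≟_; <⇒≢; suc-injective)
open import Data.Nat.Solver using (module +-*-Solver)
open import Data.Product using (Σ; ∃-syntax; _×_; _,_; proj₁; proj₂; uncurry)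
open import Data.Product.Function.NonDependent.Propositional using (_×-↔_)
open import Data.Rational using (mkℚ; 0ℚ; 1ℚ; _/_)
open import Data.Rational.Properties using (↥p/↧p≡p; negative⁻¹; positive⁻¹)
open import Data.Sum using (_⊎_; inj₁; inj₂; swap; [_,_]′)
open import Data.Vec.Base using ([]; _∷_; here; there)
import Data.Vec.Functional as Vector
open import Function using (_∘_; id)
open import Function.Bundles using (_↔_; Inverse; Equivalence)
open import Function.Properties.Inverse using (↔-refl; ↔-trans)
open import Relation.Binary.Construct.Closure.ReflexiveTransitive using (Star; ε; _◅_; _◅◅_)
open import Relation.Binary.PropositionalEquality
  using (_≡_; _≢_; refl; sym; trans; cong; cong₂; subst; _≗_)
open import Relation.Nullary using (¬_; Dec; yes; no)
open import Relation.Nullary.Decidable using (⌊_⌋; toWitness; fromWitness; ¬?; _×-dec_; _⊎-dec_)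
open import Relation.Unary using (Decidable)
open import Defs

T-xor⇒not : ∀ a b → T (a xor b) → a ≡ not b
T-xor⇒not true  false _ = refl
T-xor⇒not false true  _ = refl

not⇒T-xor : ∀ a b → a ≡ not b → T (a xor b)
not⇒T-xor true  false _ = _
not⇒T-xor false true  _ = _

-- Brooms

module Bipartite (m n : ℕ) where

  G : Graph
  G = K m n

  open Graph G using (_~_; Vertex)

  opaque
    side : Vertex → Bool
    side v = ⌊ toℕ v <? m ⌋

    ~⇒opposite : ∀ {u v} → u ~ v → side u ≡ not (side v)
    ~⇒opposite {u} {v} = T-xor⇒not ⌊ toℕ u <? m ⌋ ⌊ toℕ v <? m ⌋

    opposite⇒~ : ∀ {u v} → side u ≡ not (side v) → u ~ v
    opposite⇒~ {u} {v} = not⇒T-xor ⌊ toℕ u <? m ⌋ ⌊ toℕ v <? m ⌋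

    side-↑ˡ : ∀ i → side (i ↑ˡ n) ≡ true
    side-↑ˡ i with toℕ (i ↑ˡ n) <? m
    ... | yes _ = refl
    ... | no ≮  = ⊥-elim (≮ (subst (_< m) (sym (toℕ-↑ˡ i n)) (toℕ<n i)))

    side-↑ʳ : ∀ j → side (m ↑ʳ j) ≡ false
    side-↑ʳ j with toℕ (m ↑ʳ j) <? m
    ... | yes < = ⊥-elim (m+n≮m m (toℕ j) (subst (_< m) (toℕ-↑ʳ m j) <))
    ... | no _  = refl

  opposite⇒≢ : ∀ {u v} → side u ≡ not (side v) → u ≢ v
  opposite⇒≢ eq refl = not-¬ refl eq

  -- Colours are taken from a function on all pairs of vertices, so that colours of edges can be
  -- compared without carrying proofs of adjacency.
  colouring : ∀ {t} (cc : Vertex → Vertex → Fin t) → (∀ u v → cc u v ≡ cc v u) → EdgeColouring G t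
  colouring cc cc-sym = record
    { colour     = λ {u} {v} _ → cc u v
    ; colour-sym = λ {u} {v} _ _ → cc-sym u v
    }

  -- A tree of diameter at most three: the vertices opposite to the root w hang from w,
  -- those on the side of w hang from z, and z itself hangs from w.
  module Broom (V : Subset (m + n)) (w z : Vertex) (w∈V : w ∈ V) (z∈V : z ∈ V)
               (z↔w : side z ≡ not (side w)) where

    parent : Vertex → Vertex
    parent v = if ⌊ side v ≟ᵇ side w ⌋ then z else w

    -- Orients every edge from child to parent, so that the edges are indexed by the vertices of `V`
    -- other than `w`.
    Link : Vertex → Vertex → Set
    Link u v = u ∈ V × u ≢ w × parent u ≡ v

    link? : ∀ u v → Dec (Link u v)
    link? u v = (u ∈? V) ×-dec ¬? (u ≟ w) ×-dec (parent u ≟ v)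

    parent-same : ∀ {v} → side v ≡ side w → parent v ≡ z
    parent-same {v} eq with side v ≟ᵇ side w
    ... | yes _ = refl
    ... | no ne = ⊥-elim (ne eq)

    parent-opposite : ∀ {v} → side v ≡ not (side w) → parent v ≡ w
    parent-opposite {v} eq with side v ≟ᵇ side w
    ... | yes eq′ = ⊥-elim (not-¬ eq′ eq)
    ... | no _    = refl

    by-side : ∀ {A : Set} v → (side v ≡ side w → A) → (side v ≡ not (side w) → A) → A
    by-side v same opp with side v ≟ᵇ side w
    ... | yes eq = same eq
    ... | no ne  = opp (¬-not ne)

    parent∈wz : ∀ v → parent v ≡ w ⊎ parent v ≡ z
    parent∈wz v = by-side v (inj₂ ∘ parent-same) (inj₁ ∘ parent-opposite)

    link⇒opposite : ∀ {u v} → Link u v → side u ≡ not (side v)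
    link⇒opposite {u} (_ , _ , refl) = by-side u
      (λ eq → trans eq (trans (sym (not-involutive _))
                (cong not (trans (sym z↔w) (cong side (sym (parent-same eq)))))))
      (λ eq → trans eq (cong (not ∘ side) (sym (parent-opposite eq))))

    link⇒∈ : ∀ {u v} → Link u v → v ∈ V
    link⇒∈ {u} (_ , _ , refl) with parent∈wz u
    ... | inj₁ eq = subst (_∈ V) (sym eq) w∈V
    ... | inj₂ eq = subst (_∈ V) (sym eq) z∈V

    opposite-sym : ∀ {a b} → a ≡ not b → b ≡ not a
    opposite-sym eq = trans (sym (not-involutive _)) (cong not (sym eq))

    opaque
      edge? : ∀ u v → Dec (Link u v ⊎ Link v u)
      edge? u v = link? u v ⊎-dec link? v u

    tree : Subgraph G
    tree = record
      { V     = V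
      ; edge  = λ u v → ⌊ edge? u v ⌋
      ; E-sym = λ e → fromWitness (swap (toWitness e))
      ; E⇒~   = λ e → opposite⇒~ ([ link⇒opposite , opposite-sym ∘ link⇒opposite ]′ (toWitness e))
      ; E⇒∈V  = λ e → [ proj₁ , link⇒∈ ]′ (toWitness e)
      }

    open Subgraph tree using (E; E-sym)

    E⇒links : ∀ {u v} → E u v → Link u v ⊎ Link v u
    E⇒links = toWitness

    link⇒E : ∀ {u v} → Link u v → E u v
    link⇒E l = fromWitness (inj₁ l)

    to-root : ∀ {u} → u ∈ V → Star E u w
    to-root {u} u∈V with u ≟ w
    ... | yes refl = ε
    ... | no u≢w   = by-side u
      (λ eq → link⇒E (u∈V , u≢w , parent-same eq)
              ◅ link⇒E (z∈V , opposite⇒≢ z↔w , parent-opposite z↔w) ◅ ε)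
      (λ eq → link⇒E (u∈V , u≢w , parent-opposite eq) ◅ ε)

    reverse : ∀ {u v} → Star E u v → Star E v u
    reverse ε        = ε
    reverse (e ◅ es) = reverse es ◅◅ (E-sym e ◅ ε)

    connected : Connected tree
    connected u∈V v∈V = to-root u∈V ◅◅ reverse (to-root v∈V)

    leaf : ∀ {u v} → u ≢ w → u ≢ z → E u v → v ≡ parent u
    leaf {u} {v} u≢w u≢z e with E⇒links e
    ... | inj₁ (_ , _ , eq) = sym eq
    ... | inj₂ (_ , _ , eq) with parent∈wz v
    ...   | inj₁ eq′ = ⊥-elim (u≢w (trans (sym eq) eq′))
    ...   | inj₂ eq′ = ⊥-elim (u≢z (trans (sym eq) eq′))

    inner : ∀ {u x y} → E u x → E u y → x ≢ y → u ≡ w ⊎ u ≡ z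
    inner {u} e f x≢y with u ≟ w | u ≟ z
    ... | yes eq | _      = inj₁ eq
    ... | no _   | yes eq = inj₂ eq
    ... | no u≢w | no u≢z = ⊥-elim (x≢y (trans (leaf u≢w u≢z e) (sym (leaf u≢w u≢z f))))

    -- Every vertex of a cycle has two distinct neighbours, but only w and z do.
    acyclic : ¬ Cycle tree
    acyclic c = absurd (inner (step zero) (E-sym close) (distinct λ ()))
                       (inner (E-sym (step zero)) (step (suc zero)) (distinct λ ()))
                       (third r at distinct step close)
      where
      open Cycle c
      distinct : ∀ {i j} → i ≢ j → at i ≢ at j
      distinct i≢j eq = i≢j (injective eq)
      -- The successor of the third vertex is the first vertex when `r` is zero, and the fourth
      -- vertex otherwise.
      third : ∀ r (at : Fin (3 + r) → Vertex) → (∀ {i j} → i ≢ j → at i ≢ at j) →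
              (∀ (i : Fin (2 + r)) → E (at (inject₁ i)) (at (suc i))) →
              E (at (fromℕ (2 + r))) (at zero) →
              at (suc (suc zero)) ≡ w ⊎ at (suc (suc zero)) ≡ z
      third ℕ.zero    at distinct step close = inner (E-sym (step (suc zero))) close (distinct λ ())
      third (ℕ.suc r) at distinct step close =
        inner (E-sym (step (suc zero))) (step (suc (suc zero))) (distinct λ ())
      absurd : at zero ≡ w ⊎ at zero ≡ z → at (suc zero) ≡ w ⊎ at (suc zero) ≡ z →
               at (suc (suc zero)) ≡ w ⊎ at (suc (suc zero)) ≡ z → ⊥
      absurd (inj₁ p) (inj₁ q) _        = distinct {zero} {suc zero} (λ ()) (trans p (sym q))
      absurd (inj₂ p) (inj₂ q) _        = distinct {zero} {suc zero} (λ ()) (trans p (sym q))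
      absurd (inj₁ p) (inj₂ q) (inj₁ s) = distinct {zero} {suc (suc zero)} (λ ()) (trans p (sym s))
      absurd (inj₁ p) (inj₂ q) (inj₂ s) = distinct {suc zero} {suc (suc zero)} (λ ()) (trans q (sym s))
      absurd (inj₂ p) (inj₁ q) (inj₁ s) = distinct {suc zero} {suc (suc zero)} (λ ()) (trans q (sym s))
      absurd (inj₂ p) (inj₁ q) (inj₂ s) = distinct {zero} {suc (suc zero)} (λ ()) (trans p (sym s))

    isTree : IsTree tree
    isTree = (w , w∈V) , connected , acyclic

    -- An edge is determined by its child end, so distinct colours on distinct children suffice;
    -- `cc-sym` handles an edge read from its parent end.
    rainbow : ∀ {t} (cc : Vertex → Vertex → Fin t) (cc-sym : ∀ u v → cc u v ≡ cc v u) →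
              (∀ u u′ → u ∈ V → u ≢ w → u′ ∈ V → u′ ≢ w →
                 cc u (parent u) ≡ cc u′ (parent u′) → u ≡ u′) →
              IsRainbow (colouring cc cc-sym) tree
    rainbow cc cc-sym inj {u} {v} {x} {y} e f eq with E⇒links e | E⇒links f
    ... | inj₁ (u∈ , u≢ , refl) | inj₁ (x∈ , x≢ , refl) with refl ← inj u x u∈ u≢ x∈ x≢ eq =
      inj₁ (refl , refl)
    ... | inj₁ (u∈ , u≢ , refl) | inj₂ (y∈ , y≢ , refl)
        with refl ← inj u y u∈ u≢ y∈ y≢ (trans eq (cc-sym _ _)) = inj₂ (refl , refl)
    ... | inj₂ (v∈ , v≢ , refl) | inj₁ (x∈ , x≢ , refl)
        with refl ← inj v x v∈ v≢ x∈ x≢ (trans (cc-sym _ _) eq) = inj₂ (refl , refl)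
    ... | inj₂ (v∈ , v≢ , refl) | inj₂ (y∈ , y≢ , refl)
        with refl ← inj v y v∈ v≢ y∈ y≢ (trans (cc-sym _ _) (trans eq (cc-sym _ _))) =
      inj₁ (refl , refl)

  -- One broom for each `i`. Hubs `z i` may coincide only when all of `S` lies opposite to the
  -- roots: then no terminal hangs from a hub, and the brooms are stars around distinct roots.
  module Brooms {t ℓ : ℕ} (cc : Vertex → Vertex → Fin t) (cc-sym : ∀ u v → cc u v ≡ cc v u)
    (S : Subset (m + n)) (b : Bool) (w z : Fin ℓ → Vertex)
    (side-w : ∀ i → side (w i) ≡ b) (side-z : ∀ i → side (z i) ≡ not b)
    (w∉S : ∀ i → w i ∉ S) (w-inj : ∀ {i j} → w i ≡ w j → i ≡ j)
    (z-collide : ∀ {i j} → i ≢ j → z i ≡ z j → z i ∈ S × (∀ v → v ∈ S → side v ≡ not b))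
    where

    V : Fin ℓ → Subset (m + n)
    V i = S ∪ (⁅ w i ⁆ ∪ ⁅ z i ⁆)

    S⊆V : ∀ i → S ⊆ V i
    S⊆V i v∈S = x∈p∪q⁺ (inj₁ v∈S)

    w∈V : ∀ i → w i ∈ V i
    w∈V i = x∈p∪q⁺ {p = S} (inj₂ (x∈p∪q⁺ (inj₁ (x∈⁅x⁆ (w i)))))

    z∈V : ∀ i → z i ∈ V i
    z∈V i = x∈p∪q⁺ {p = S} (inj₂ (x∈p∪q⁺ {p = ⁅ w i ⁆} (inj₂ (x∈⁅x⁆ (z i)))))

    ∈V⁻ : ∀ i {v} → v ∈ V i → v ∈ S ⊎ v ≡ w i ⊎ v ≡ z i
    ∈V⁻ i v∈ with x∈p∪q⁻ S _ v∈
    ... | inj₁ v∈S = inj₁ v∈S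
    ... | inj₂ v∈′ with x∈p∪q⁻ ⁅ w i ⁆ ⁅ z i ⁆ v∈′
    ...   | inj₁ p = inj₂ (inj₁ (x∈⁅y⁆⇒x≡y _ p))
    ...   | inj₂ p = inj₂ (inj₂ (x∈⁅y⁆⇒x≡y _ p))

    side-zw : ∀ i → side (z i) ≡ not (side (w i))
    side-zw i = trans (side-z i) (cong not (sym (side-w i)))

    module B (i : Fin ℓ) = Broom (V i) (w i) (z i) (w∈V i) (z∈V i) (side-zw i)

    w≢z : ∀ i j → w i ≢ z j
    w≢z i j eq = not-¬ (trans (cong side (sym eq)) (side-w i)) (side-z j)

    shared∈S : ∀ {i j} → i ≢ j → ∀ {v} → v ∈ V i → v ∈ V j → v ∈ S
    shared∈S {i} {j} i≢j v∈i v∈j with ∈V⁻ i v∈i | ∈V⁻ j v∈j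
    ... | inj₁ v∈S         | _                = v∈S
    ... | inj₂ _           | inj₁ v∈S         = v∈S
    ... | inj₂ (inj₁ refl) | inj₂ (inj₁ eq)   = ⊥-elim (i≢j (w-inj eq))
    ... | inj₂ (inj₁ refl) | inj₂ (inj₂ eq)   = ⊥-elim (w≢z i j eq)
    ... | inj₂ (inj₂ refl) | inj₂ (inj₁ eq)   = ⊥-elim (w≢z j i (sym eq))
    ... | inj₂ (inj₂ refl) | inj₂ (inj₂ eq)   = proj₁ (z-collide i≢j eq)

    -- Roots lie outside `S`, so a parent in `S` is the hub, and only vertices on the side of the
    -- root hang from the hub.
    link-in-S : ∀ i {u v} → v ∈ S → B.Link i u v → side u ≡ b × z i ≡ v
    link-in-S i {u} v∈S (_ , _ , eq) = B.by-side i u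
      (λ s → trans s (side-w i) , trans (sym (B.parent-same i s)) eq)
      (λ s → ⊥-elim (w∉S i (subst (_∈ S) (trans (sym eq) (B.parent-opposite i s)) v∈S)))

    -- Used in the same direction by both trees, the edge forces equal hubs, and `z-collide` then
    -- puts `u` on the wrong side; used in opposite directions, it puts `v` on both sides.
    links-disjoint : ∀ {i j} → i ≢ j → ∀ {u v} → u ∈ S → v ∈ S →
                     B.Link i u v → B.Link j u v ⊎ B.Link j v u → ⊥
    links-disjoint {i} {j} i≢j {u} u∈S v∈S l l′ with link-in-S i v∈S l
    ... | u-b , zi≡v with l′
    ...   | inj₁ l″ =
      not-¬ u-b (proj₂ (z-collide i≢j (trans zi≡v (sym (proj₂ (link-in-S j v∈S l″))))) u u∈S)
    ...   | inj₂ l″ =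
      not-¬ (trans (cong side zi≡v) (proj₁ (link-in-S j u∈S l″))) (side-z i)

    edges-disjoint : ∀ {i j} → i ≢ j → ∀ {u v} →
                     Subgraph.E (B.tree i) u v → Subgraph.E (B.tree j) u v → ⊥
    edges-disjoint {i} {j} i≢j e f = by-link (B.E⇒links i e)
      where
      u∈S = shared∈S i≢j (Subgraph.E⇒∈V (B.tree i) e) (Subgraph.E⇒∈V (B.tree j) f)
      v∈S = shared∈S i≢j (Subgraph.E⇒∈V (B.tree i) (Subgraph.E-sym (B.tree i) e))
                         (Subgraph.E⇒∈V (B.tree j) (Subgraph.E-sym (B.tree j) f))
      by-link : _ → ⊥
      by-link (inj₁ l) = links-disjoint i≢j u∈S v∈S l (B.E⇒links j f)
      by-link (inj₂ l) = links-disjoint i≢j v∈S u∈S l (swap (B.E⇒links j f))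

    brooms : (∀ i u u′ → (u ∈ S ⊎ u ≡ z i) → (u′ ∈ S ⊎ u′ ≡ z i) →
                cc u (B.parent i u) ≡ cc u′ (B.parent i u′) → u ≡ u′) →
             Σ (Fin ℓ → Subgraph G) λ Ts →
               (∀ i → IsRainbowTreeConnecting (colouring cc cc-sym) S (Ts i)) × InternallyDisjoint S Ts
    brooms inj = B.tree
      , (λ i → B.isTree i , S⊆V i , λ {u} {v} {x} {y} →
           B.rainbow i cc cc-sym (λ u u′ u∈ u≢ u′∈ u′≢ → inj i u u′ (drop i u∈ u≢) (drop i u′∈ u′≢))
             {u} {v} {x} {y})
      , λ i j i≢j →
          (λ u v (e , f) → edges-disjoint i≢j e f)
        , ⊆-antisym (λ v∈ → let p , q = x∈p∩q⁻ (V i) (V j) v∈ in shared∈S i≢j p q)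
                    (λ v∈ → x∈p∩q⁺ (S⊆V i v∈ , S⊆V j v∈))
      where
      drop : ∀ i {v} → v ∈ V i → v ≢ w i → v ∈ S ⊎ v ≡ z i
      drop i v∈ v≢ with ∈V⁻ i v∈
      ... | inj₁ p        = inj₁ p
      ... | inj₂ (inj₁ p) = ⊥-elim (v≢ p)
      ... | inj₂ (inj₂ p) = inj₂ p

-- The explicit colouring

-- Without a missed value, choosing preimages would map `Fin b` into `Fin a`, and a collision there
-- would identify two different values.
missed-value : ∀ {a b} → a < b → (g : Fin a → Fin b) → ∃[ e ] (∀ i → g i ≢ e)
missed-value a<b g with any? (λ e → all? (λ i → ¬? (g i ≟ e)))
... | yes found = found
... | no none   = ⊥-elim (clash (pigeonhole a<b (λ e → proj₁ (preimage e))))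
  where
  preimage : ∀ e → ∃[ i ] g i ≡ e
  preimage e with any? (λ i → g i ≟ e)
  ... | yes p = p
  ... | no ¬p = ⊥-elim (none (e , λ i eq → ¬p (i , eq)))
  clash : ¬ (∃[ e ] ∃[ e′ ] (toℕ e < toℕ e′ × proj₁ (preimage e) ≡ proj₁ (preimage e′)))
  clash (e , e′ , e<e′ , eq) =
    <⇒≢ e<e′ (trans (sym (proj₂ (preimage e))) (trans (cong g eq) (proj₂ (preimage e′))))

funToFin-injective : ∀ {a b} {f g : Fin a → Fin b} → funToFin f ≡ funToFin g → f ≗ g
funToFin-injective {f = f} {g} eq i =
  trans (sym (finToFun-funToFin f i)) (trans (cong (λ c → finToFun c i) eq) (finToFun-funToFin g i))

funToFin-cong : ∀ {a b} {f g : Fin a → Fin b} → f ≗ g → funToFin f ≡ funToFin g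
funToFin-cong {0} eq = refl
funToFin-cong {suc a} eq = cong₂ combine (eq zero) (funToFin-cong (eq ∘ suc))

module CodeColouring
  (m n t ℓ κ D : ℕ) (t₀ : Fin t) (d₀ : Fin D) (m+n≤2^D : m + n ≤ 2 ^ D) where

  open Bipartite m n

  open Graph G using (Vertex)

  -- There is one probe for each ordered pair of `κ` vertices. Together, `κ` vertices carry `κ`
  -- marks and `κ * κ` targets, so `M` values always leave one mark fresh.
  r M alphabet size : ℕ
  r        = κ * κ
  M        = suc (κ * suc κ)
  alphabet = ℓ * (M * (M ^ κ * t ^ (2 ^ r)))
  size     = D ^ r * alphabet

  -- In order: probed positions, copy number, mark, list of targets, table. Copy numbers keep the
  -- centres of different trees apart; marks and targets settle which end of an edge decides its
  -- colour.
  Code : Set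
  Code = Fin (D ^ r) × Fin ℓ × Fin M × Fin (M ^ κ) × Fin (t ^ (2 ^ r))

  Fin↔Code : Fin size ↔ Code
  Fin↔Code = split (split (split *↔×))
    where
    split : ∀ {a b} {B : Set} → Fin b ↔ B → Fin (a * b) ↔ (Fin a × B)
    split f = ↔-trans *↔× (↔-refl ×-↔ f)

  probe : Code → Fin r → Fin D
  probe (P , _) = finToFun P

  copy : Code → Fin ℓ
  copy (_ , s , _) = s

  mark : Code → Fin M
  mark (_ , _ , a , _) = a

  targets : Code → Fin κ → Fin M
  targets (_ , _ , _ , J , _) = finToFun J

  table : Code → Fin (2 ^ r) → Fin t
  table (_ , _ , _ , _ , F) = finToFun F

  -- The name of `v`: its number written with `D` binary digits.
  bits : Vertex → Fin D → Fin 2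
  bits v = finToFun (inject≤ v m+n≤2^D)

  bits-injective : ∀ {u v} → bits u ≗ bits v → u ≡ v
  bits-injective {u} {v} eq = inject≤-injective m+n≤2^D m+n≤2^D u v
    (trans (sym (funToFin-finToFin {D} {2} (inject≤ u m+n≤2^D)))
      (trans (funToFin-cong eq) (funToFin-finToFin {D} {2} (inject≤ v m+n≤2^D))))

  -- Phrased as an implication so that equal vertices also receive a position, the arbitrary `d₀`.
  separator : ∀ u v → ∃[ p ] (bits u p ≡ bits v p → u ≡ v)
  separator u v with all? (λ p → bits u p ≟ bits v p)
  ... | yes eq = d₀ , λ _ → bits-injective eq
  ... | no ¬eq with p , ne ← ¬∀⟶∃¬ D _ (λ p → bits u p ≟ bits v p) ¬eq = p , λ eq → ⊥-elim (ne eq)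

  trace : (Fin r → Fin D) → Vertex → Fin (2 ^ r)
  trace P v = funToFin (λ q → bits v (P q))

  -- Probing one separating bit for each pair of the x i makes their traces distinct.
  prescribe : (x : Fin κ → Vertex) (f : Vertex → Fin t) →
              Σ (Fin r → Fin D) λ P → Σ (Fin (2 ^ r) → Fin t) λ F → ∀ i → F (trace P (x i)) ≡ f (x i)
  prescribe x f = P , F , F-trace
    where
    P : Fin r → Fin D
    P q = uncurry (λ i j → proj₁ (separator (x i) (x j))) (remQuot {κ} κ q)
    trace-injective : ∀ i j → trace P (x i) ≡ trace P (x j) → x i ≡ x j
    trace-injective i j eq = proj₂ (separator (x i) (x j))
      (subst (λ ij → bits (x i) (at ij) ≡ bits (x j) (at ij)) (remQuot-combine i j)
        (funToFin-injective {f = λ q → bits (x i) (P q)} {g = λ q → bits (x j) (P q)} eq (combine i j)))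
      where
      at : Fin κ × Fin κ → Fin D
      at (i , j) = proj₁ (separator (x i) (x j))
    -- Indices with the same trace name the same vertex, so any of them may be chosen; traces of no
    -- `x i` get the default `t₀`.
    F : Fin (2 ^ r) → Fin t
    F c with any? (λ i → trace P (x i) ≟ c)
    ... | yes (i , _) = f (x i)
    ... | no _        = t₀
    F-trace : ∀ i → F (trace P (x i)) ≡ f (x i)
    F-trace i with any? (λ j → trace P (x j) ≟ trace P (x i))
    ... | yes (j , eq) = cong f (trace-injective j i eq)
    ... | no ¬p        = ⊥-elim (¬p (i , refl))

  module _ (size≤m : size ≤ m) (size≤n : size ≤ n) .{{_ : NonZero size}} where

    index : Vertex → ℕ
    index v = [ toℕ , toℕ ]′ (splitAt m v)

    -- Codes are assigned cyclically within each class, so every code occurs on both sides once both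
    -- classes have `size` vertices.
    code : Vertex → Code
    code v = Inverse.to Fin↔Code (index v mod size)

    with-index : ∀ b (c : Fin size) → ∃[ v ] (side v ≡ b × index v ≡ toℕ c)
    with-index true c = inject≤ c size≤m ↑ˡ n , side-↑ˡ _
      , trans (cong [ toℕ , toℕ ]′ (splitAt-↑ˡ m _ n)) (toℕ-inject≤ c size≤m)
    with-index false c = m ↑ʳ inject≤ c size≤n , side-↑ʳ _
      , trans (cong [ toℕ , toℕ ]′ (splitAt-↑ʳ m n _)) (toℕ-inject≤ c size≤n)

    toℕ-mod : ∀ (c : Fin size) → toℕ c mod size ≡ c
    toℕ-mod c = toℕ-injective (trans (toℕ-fromℕ< _) (m<n⇒m%n≡m (toℕ<n c)))

    with-code : ∀ b (c : Code) → ∃[ v ] (side v ≡ b × code v ≡ c)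
    with-code b c with v , v-b , eq ← with-index b (Inverse.from Fin↔Code c) =
      v , v-b , trans (cong (Inverse.to Fin↔Code) (trans (cong (_mod size) eq) (toℕ-mod _)))
                      (Inverse.strictlyInverseˡ Fin↔Code c)

    lookup-in : Vertex → Vertex → Fin t
    lookup-in v u = table (code v) (trace (probe (code v)) u)

    claims? : ∀ u v → Dec (∃[ j ] targets (code v) j ≡ mark (code u))
    claims? u v = any? (λ j → targets (code v) j ≟ mark (code u))

    -- For u in the first class and v in the second: v decides the colour if it lists the
    -- mark of u, and otherwise u does.  Each class can thus force a colour: v by listing
    -- the marks of given vertices u, and u by having a mark that given vertices v do not list.
    rule : Vertex → Vertex → Fin t
    rule u v = if ⌊ claims? u v ⌋ then lookup-in v u else lookup-in u v

    cc : Vertex → Vertex → Fin t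
    cc u v with side u | side v
    ... | true  | false = rule u v
    ... | false | true  = rule v u
    ... | true  | true  = t₀
    ... | false | false = t₀

    cc-sym : ∀ u v → cc u v ≡ cc v u
    cc-sym u v with side u | side v
    ... | true  | false = refl
    ... | false | true  = refl
    ... | true  | true  = refl
    ... | false | false = refl

    cc-rule : ∀ u v → side u ≡ true → side v ≡ false → cc u v ≡ rule u v
    cc-rule u v p q with true ← side u | false ← side v = refl

    rule-claimed : ∀ u v j → targets (code v) j ≡ mark (code u) → rule u v ≡ lookup-in v u
    rule-claimed u v j eq with claims? u v
    ... | yes _ = refl
    ... | no ¬p = ⊥-elim (¬p (j , eq))

    rule-unclaimed : ∀ u v → (∀ j → targets (code v) j ≢ mark (code u)) → rule u v ≡ lookup-in u v
    rule-unclaimed u v ne with claims? u v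
    ... | yes (j , eq) = ⊥-elim (ne j eq)
    ... | no _         = refl

    -- Choose `w` by its code: a fresh mark, the marks of the `x i` as targets, and the probes and
    -- table of `prescribe`. Then `w` decides the colours of its edges to the `x i`, whichever class
    -- it lies in.
    universal : (x : Fin κ → Vertex) (f : Vertex → Fin t) (b : Bool) (s : Fin ℓ) →
                ∃[ w ] ((∀ i → w ≢ x i) × side w ≡ b × copy (code w) ≡ s ×
                        (∀ i → side (x i) ≡ not b → cc (x i) w ≡ f (x i)))
    universal x f b s = w , w≢x , side-w , cong copy code-w , forced b refl
      where
      P = proj₁ (prescribe x f)
      F = proj₁ (proj₂ (prescribe x f))
      -- Avoiding the marks makes `w` differ from every `x i`; avoiding the targets keeps every
      -- `x i` from claiming `w`.
      taken : Fin κ × Fin (suc κ) → Fin M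
      taken (i , zero)  = mark (code (x i))
      taken (i , suc j) = targets (code (x i)) j
      fresh = missed-value (n<1+n (κ * suc κ)) (taken ∘ remQuot {κ} (suc κ))
      a = proj₁ fresh
      a-fresh : ∀ i j → taken (i , j) ≢ a
      a-fresh i j eq = proj₂ fresh (combine i j) (trans (cong taken (remQuot-combine i j)) eq)
      c : Code
      c = funToFin P , s , a , funToFin (λ i → mark (code (x i))) , funToFin F
      w = proj₁ (with-code b c)
      side-w : side w ≡ b
      side-w = proj₁ (proj₂ (with-code b c))
      code-w : code w ≡ c
      code-w = proj₂ (proj₂ (with-code b c))
      w≢x : ∀ i → w ≢ x i
      w≢x i eq = a-fresh i zero (trans (cong (mark ∘ code) (sym eq)) (cong mark code-w))
      targets-w : ∀ i → targets (code w) i ≡ mark (code (x i))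
      targets-w i = trans (cong (λ e → targets e i) code-w) (finToFun-funToFin (λ i → mark (code (x i))) i)
      lookup-w : ∀ i → lookup-in w (x i) ≡ f (x i)
      lookup-w i = trans (cong (λ e → table e (trace (probe e) (x i))) code-w)
        (trans (finToFun-funToFin F _)
          (trans (cong F (funToFin-cong (λ q → cong (bits (x i)) (finToFun-funToFin P q))))
            (proj₂ (proj₂ (prescribe x f)) i)))
      -- In the second class `w` decides because it claims every `x i`; in the first it decides
      -- because no `x i` claims it.
      forced : ∀ b′ → b ≡ b′ → ∀ i → side (x i) ≡ not b → cc (x i) w ≡ f (x i)
      forced false refl i opp =
        trans (cc-rule (x i) w opp side-w) (trans (rule-claimed (x i) w i (targets-w i)) (lookup-w i))
      forced true refl i opp =
        trans (cc-sym (x i) w) (trans (cc-rule w (x i) side-w opp)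
          (trans (rule-unclaimed w (x i) λ j eq → a-fresh i (suc j) (trans eq (cong mark code-w)))
            (lookup-w i)))

-- Rainbow trees from the colouring

record Enumeration {n : ℕ} (S : Subset n) (k : ℕ) : Set where
  field
    at           : Fin k → Fin n
    at∈          : ∀ i → at i ∈ S
    at-injective : ∀ {i j} → at i ≡ at j → i ≡ j
    covers       : ∀ {v} → v ∈ S → ∃[ i ] at i ≡ v

enumerate : ∀ {n} (S : Subset n) → Enumeration S ∣ S ∣
enumerate []            = record { at = λ () ; at∈ = λ () ; at-injective = λ { {()} } ; covers = λ () }
enumerate (outside ∷ S) = record
  { at           = suc ∘ at
  ; at∈          = there ∘ at∈
  ; at-injective = λ { eq → at-injective (suc-injective eq) }
  ; covers       = λ { (there v∈) → let i , eq = covers v∈ in i , cong suc eq }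
  }
  where
  open Enumeration (enumerate S)

enumerate (inside ∷ S) = record
  { at           = λ { zero → zero ; (suc i) → suc (at i) }
  ; at∈          = λ { zero → here ; (suc i) → there (at∈ i) }
  ; at-injective = λ { {zero} {zero} _ → refl
                     ; {suc i} {suc j} eq → cong suc (at-injective (suc-injective eq)) }
  ; covers       = λ { here → zero , refl ; (there v∈) → let i , eq = covers v∈ in suc i , cong suc eq }
  }
  where
  open Enumeration (enumerate S)

module _ (m n : ℕ) where

  open Bipartite m n
  open Graph G using (Vertex)

  -- Isolates what the tree constructions use of the explicit colouring; the `ℓ` values of `copy`
  -- yield `ℓ` distinct solutions of one extension problem.
  record UniversalColouring (t κ ℓ : ℕ) : Set where
    field
      cc     : Vertex → Vertex → Fin t
      cc-sym : ∀ u v → cc u v ≡ cc v u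
      copy   : Vertex → Fin ℓ
      extend : (x : Fin κ → Vertex) (f : Vertex → Fin t) (b : Bool) (s : Fin ℓ) →
               ∃[ w ] ((∀ i → w ≢ x i) × side w ≡ b × copy w ≡ s ×
                       (∀ i → side (x i) ≡ not b → cc (x i) w ≡ f (x i)))

module RainbowTrees {m n t k ℓ : ℕ} (UC : UniversalColouring m n t (suc k) ℓ)
  (S : Subset (m + n)) (enum : Enumeration S k) where

  open Bipartite m n
  open Graph G using (Vertex)
  open UniversalColouring UC
  open Enumeration enum

  RainbowTrees : Set
  RainbowTrees = Σ (Fin ℓ → Subgraph G) λ Ts →
    (∀ i → IsRainbowTreeConnecting (colouring cc cc-sym) S (Ts i)) × InternallyDisjoint S Ts

  -- The vertex `y` beside the `k` terminals lets a second centre also prescribe the colour of its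
  -- edge to a first one.
  record Centre (y : Vertex) (f : Vertex → Fin t) (b : Bool) (s : Fin ℓ) : Set where
    field
      w       : Vertex
      w∉S     : w ∉ S
      side-w  : side w ≡ b
      copy-w  : copy w ≡ s
      on-S    : ∀ {v} → v ∈ S → side v ≡ not b → cc v w ≡ f v
      on-y    : side y ≡ not b → cc y w ≡ f y

  centre : ∀ y f b s → Centre y f b s
  centre y f b s with w , w≢ , side-w , copy-w , ext ← extend (y Vector.∷ at) f b s = record
    { w      = w
    ; w∉S    = λ w∈ → let i , eq = covers w∈ in w≢ (suc i) (sym eq)
    ; side-w = side-w
    ; copy-w = copy-w
    ; on-S   = λ v∈ opp → on-S (covers v∈) opp
    ; on-y   = ext zero
    }
    where
    on-S : ∀ {v} → ∃[ i ] at i ≡ v → side v ≡ not b → cc v w ≡ f v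
    on-S (i , refl) = ext (suc i)

  label : k ≤ t → Fin t → Vertex → Fin t
  label k≤t d v with any? (λ i → at i ≟ v)
  ... | yes (i , _) = inject≤ i k≤t
  ... | no _        = d

  label-at : ∀ k≤t d {v} → v ∈ S → ∃[ i ] (at i ≡ v × label k≤t d v ≡ inject≤ i k≤t)
  label-at k≤t d {v} v∈ with any? (λ i → at i ≟ v)
  ... | yes (i , eq) = i , eq , refl
  ... | no ¬p        = ⊥-elim (¬p (covers v∈))

  label-∉ : ∀ k≤t d {v} → v ∉ S → label k≤t d v ≡ d
  label-∉ k≤t d {v} v∉ with any? (λ i → at i ≟ v)
  ... | yes (i , eq) = ⊥-elim (v∉ (subst (_∈ S) eq (at∈ i)))
  ... | no _         = refl

  label-injective : ∀ k≤t d {u v} → u ∈ S → v ∈ S → label k≤t d u ≡ label k≤t d v → u ≡ v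
  label-injective k≤t d u∈ v∈ eq with label-at k≤t d u∈ | label-at k≤t d v∈
  ... | i , refl , p | j , refl , q =
    cong at (inject≤-injective k≤t k≤t i j (trans (sym p) (trans eq q)))

  same-copy : ∀ {y y′ f f′ b b′ i j} (C : Centre y f b i) (C′ : Centre y′ f′ b′ j) →
              Centre.w C ≡ Centre.w C′ → i ≡ j
  same-copy C C′ eq = trans (sym (Centre.copy-w C)) (trans (cong copy eq) (Centre.copy-w C′))

  -- Each tree has two new centres, one per side, joined by an edge of colour `d`; every terminal
  -- hangs from the centre opposite to it. The labels of the terminals are distinct and differ from
  -- `d`.
  double-stars : (k≤t : k ≤ t) (d : Fin t) → (∀ i → inject≤ i k≤t ≢ d) → Vertex → RainbowTrees
  double-stars k≤t d fresh v₀ =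
    brooms λ i u u′ u∈ u′∈ eq → distinct i u∈ u′∈ (trans (sym (colour i u∈)) (trans eq (colour i u′∈)))
    where
    g = label k≤t d
    W : ∀ i → Centre v₀ g true i
    W i = centre v₀ g true i
    w : Fin ℓ → Vertex
    w i = Centre.w (W i)
    -- Found after `w i` and with it as extra vertex: since `w i` is outside `S`, its label gives
    -- the middle edge the colour `d`.
    Z : ∀ i → Centre (w i) g false i
    Z i = centre (w i) g false i
    z : Fin ℓ → Vertex
    z i = Centre.w (Z i)
    open Brooms cc cc-sym S true w z (Centre.side-w ∘ W) (Centre.side-w ∘ Z) (Centre.w∉S ∘ W)
      (λ {i} {j} → same-copy (W i) (W j)) (λ {i} {j} i≢j eq → ⊥-elim (i≢j (same-copy (Z i) (Z j) eq)))
    colour : ∀ i {u} → u ∈ S ⊎ u ≡ z i → cc u (B.parent i u) ≡ g u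
    colour i {u} (inj₁ u∈) = B.by-side i u
      (λ eq → trans (cong (cc u) (B.parent-same i eq))
                (Centre.on-S (Z i) u∈ (trans eq (Centre.side-w (W i)))))
      (λ eq → trans (cong (cc u) (B.parent-opposite i eq))
                (Centre.on-S (W i) u∈ (trans eq (cong not (Centre.side-w (W i))))))
    colour i (inj₂ refl) =
      trans (cong (cc (z i)) (B.parent-opposite i (side-zw i)))
        (trans (cc-sym (z i) (w i)) (trans (Centre.on-y (Z i) (Centre.side-w (W i)))
          (trans (label-∉ k≤t d (Centre.w∉S (W i))) (sym (label-∉ k≤t d (Centre.w∉S (Z i)))))))
    d∉labels : ∀ {u v} → u ∈ S → v ∉ S → g u ≢ g v
    d∉labels u∈ v∉ eq with i , _ , p ← label-at k≤t d u∈ =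
      fresh i (trans (sym p) (trans eq (label-∉ k≤t d v∉)))
    distinct : ∀ i {u u′} → u ∈ S ⊎ u ≡ z i → u′ ∈ S ⊎ u′ ≡ z i → g u ≡ g u′ → u ≡ u′
    distinct i (inj₁ u∈)   (inj₁ u′∈)  eq = label-injective k≤t d u∈ u′∈ eq
    distinct i (inj₁ u∈)   (inj₂ refl) eq = ⊥-elim (d∉labels u∈ (Centre.w∉S (Z i)) eq)
    distinct i (inj₂ refl) (inj₁ u′∈)  eq = ⊥-elim (d∉labels u′∈ (Centre.w∉S (Z i)) (sym eq))
    distinct i (inj₂ refl) (inj₂ refl) eq = refl

  -- Terminals on one side all hang from one new centre, so `k` colours are enough; a terminal fills
  -- the place of the hub.
  stars : k ≤ t → Fin t → ∀ b {z₀} → z₀ ∈ S → (∀ v → v ∈ S → side v ≡ not b) → RainbowTrees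
  stars k≤t d b {z₀} z₀∈ one-sided =
    brooms λ i u u′ u∈ u′∈ eq → label-injective k≤t d (in-S u∈) (in-S u′∈)
      (trans (sym (colour i (in-S u∈))) (trans eq (colour i (in-S u′∈))))
    where
    g = label k≤t d
    W : ∀ i → Centre z₀ g b i
    W i = centre z₀ g b i
    open Brooms cc cc-sym S b (λ i → Centre.w (W i)) (λ _ → z₀) (Centre.side-w ∘ W) (λ _ → one-sided z₀ z₀∈)
      (Centre.w∉S ∘ W) (λ {i} {j} → same-copy (W i) (W j)) (λ _ _ → z₀∈ , one-sided)
    in-S : ∀ {u} → u ∈ S ⊎ u ≡ z₀ → u ∈ S
    in-S (inj₁ u∈)   = u∈
    in-S (inj₂ refl) = z₀∈
    colour : ∀ i {u} → u ∈ S → cc u (B.parent i u) ≡ g u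
    colour i {u} u∈ = trans
      (cong (cc u) (B.parent-opposite i (trans (one-sided u u∈) (cong not (sym (Centre.side-w (W i)))))))
      (Centre.on-S (W i) u∈ (one-sided u u∈))

-- Three colours for three terminals

next : Fin 3 → Fin 3
next zero             = suc zero
next (suc zero)       = suc (suc zero)
next (suc (suc zero)) = zero

next-≢ : ∀ c → c ≢ next c
next-≢ (suc zero)       ()
next-≢ (suc (suc zero)) ()

next²-≢ : ∀ c → c ≢ next (next c)
next²-≢ zero             ()
next²-≢ (suc zero)       ()
next²-≢ (suc (suc zero)) ()

module ThreeColours {m n ℓ : ℕ} (UC : UniversalColouring m n 3 4 ℓ)
  (S : Subset (m + n)) (enum : Enumeration S 3) where

  open Bipartite m n
  open Graph G using (Vertex)
  open UniversalColouring UC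
  open Enumeration enum
  open RainbowTrees UC S enum

  -- The i-th tree is a path v — p — w — q, where p and q are swapped according to i.
  paths : (choose : Fin ℓ → Bool) → (∀ {i j} → choose i ≡ choose j → i ≡ j) →
          ∀ {p q v} b → p ∈ S → q ∈ S → v ∈ S → p ≢ q →
          side p ≡ not b → side q ≡ not b → side v ≡ b →
          (∀ {u} → u ∈ S → u ≡ p ⊎ u ≡ q ⊎ u ≡ v) → RainbowTrees
  paths choose choose-injective {p} {q} {v} b p∈ q∈ v∈ p≢q side-p side-q side-v S-pqv =
    brooms λ i u u′ u∈ u′∈ eq → separate i (position i u∈) (position i u′∈) eq
    where
    -- The trees need different edges at `v`, hence different hubs; the two possible hubs provide
    -- for at most two trees.
    z o : Fin ℓ → Vertex
    z i = if choose i then p else q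
    o i = if choose i then q else p
    z≢o : ∀ i → z i ≢ o i
    z≢o i with choose i
    ... | true  = p≢q
    ... | false = p≢q ∘ sym
    z∈ : ∀ i → z i ∈ S
    z∈ i with choose i
    ... | true  = p∈
    ... | false = q∈
    o∈ : ∀ i → o i ∈ S
    o∈ i with choose i
    ... | true  = q∈
    ... | false = p∈
    z-side : ∀ i → side (z i) ≡ not b
    z-side i with choose i
    ... | true  = side-p
    ... | false = side-q
    o-side : ∀ i → side (o i) ≡ not b
    o-side i with choose i
    ... | true  = side-q
    ... | false = side-p
    z-injective : ∀ {i j} → z i ≡ z j → i ≡ j
    z-injective {i} {j} eq = choose-injective (same (choose i) (choose j) eq)
      where
      same : ∀ a c → (if a then p else q) ≡ (if c then p else q) → a ≡ c
      same true  true  _  = refl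
      same false false _  = refl
      same true  false eq = ⊥-elim (p≢q eq)
      same false true  eq = ⊥-elim (p≢q (sym eq))
    position : ∀ i {u} → u ∈ S ⊎ u ≡ z i → u ≡ z i ⊎ u ≡ o i ⊎ u ≡ v
    position i (inj₂ eq) = inj₁ eq
    position i (inj₁ u∈) with choose i | S-pqv u∈
    ... | true  | inj₁ eq        = inj₁ eq
    ... | true  | inj₂ (inj₁ eq) = inj₂ (inj₁ eq)
    ... | false | inj₁ eq        = inj₂ (inj₁ eq)
    ... | false | inj₂ (inj₁ eq) = inj₁ eq
    ... | _     | inj₂ (inj₂ eq) = inj₂ (inj₂ eq)
    -- The edge from `v` to `z i` joins two terminals, so its colour is given; the two edges at the
    -- new centre are prescribed the other two colours.
    c₀ : Fin ℓ → Fin 3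
    c₀ i = cc v (z i)
    f : Fin ℓ → Vertex → Fin 3
    f i u with u ≟ z i
    ... | yes _ = next (c₀ i)
    ... | no _  = next (next (c₀ i))
    f-z : ∀ i → f i (z i) ≡ next (c₀ i)
    f-z i with z i ≟ z i
    ... | yes _ = refl
    ... | no ne = ⊥-elim (ne refl)
    f-o : ∀ i → f i (o i) ≡ next (next (c₀ i))
    f-o i with o i ≟ z i
    ... | yes eq = ⊥-elim (z≢o i (sym eq))
    ... | no _   = refl
    W : ∀ i → Centre v (f i) b i
    W i = centre v (f i) b i
    open Brooms cc cc-sym S b (λ i → Centre.w (W i)) z (Centre.side-w ∘ W) z-side (Centre.w∉S ∘ W)
      (λ {i} {j} → same-copy (W i) (W j)) (λ i≢j eq → ⊥-elim (i≢j (z-injective eq)))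
    to-w : ∀ i {u} → u ∈ S → side u ≡ not b → cc u (B.parent i u) ≡ f i u
    to-w i {u} u∈ opp = trans
      (cong (cc u) (B.parent-opposite i (trans opp (cong not (sym (Centre.side-w (W i)))))))
      (Centre.on-S (W i) u∈ opp)
    colour-z : ∀ i → cc (z i) (B.parent i (z i)) ≡ next (c₀ i)
    colour-z i = trans (to-w i (z∈ i) (z-side i)) (f-z i)
    colour-o : ∀ i → cc (o i) (B.parent i (o i)) ≡ next (next (c₀ i))
    colour-o i = trans (to-w i (o∈ i) (o-side i)) (f-o i)
    colour-v : ∀ i → cc v (B.parent i v) ≡ c₀ i
    colour-v i = cong (cc v) (B.parent-same i (trans side-v (sym (Centre.side-w (W i)))))
    separate : ∀ i {u u′} → u ≡ z i ⊎ u ≡ o i ⊎ u ≡ v → u′ ≡ z i ⊎ u′ ≡ o i ⊎ u′ ≡ v →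
               cc u (B.parent i u) ≡ cc u′ (B.parent i u′) → u ≡ u′
    separate i (inj₁ refl)        (inj₁ refl)        eq = refl
    separate i (inj₂ (inj₁ refl)) (inj₂ (inj₁ refl)) eq = refl
    separate i (inj₂ (inj₂ refl)) (inj₂ (inj₂ refl)) eq = refl
    separate i (inj₁ refl)        (inj₂ (inj₁ refl)) eq =
      ⊥-elim (next-≢ _ (trans (sym (colour-z i)) (trans eq (colour-o i))))
    separate i (inj₁ refl)        (inj₂ (inj₂ refl)) eq =
      ⊥-elim (next-≢ _ (trans (sym (colour-v i)) (trans (sym eq) (colour-z i))))
    separate i (inj₂ (inj₁ refl)) (inj₁ refl)        eq =
      ⊥-elim (next-≢ _ (trans (sym (colour-z i)) (trans (sym eq) (colour-o i))))
    separate i (inj₂ (inj₁ refl)) (inj₂ (inj₂ refl)) eq =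
      ⊥-elim (next²-≢ _ (trans (sym (colour-v i)) (trans (sym eq) (colour-o i))))
    separate i (inj₂ (inj₂ refl)) (inj₁ refl)        eq =
      ⊥-elim (next-≢ _ (trans (sym (colour-v i)) (trans eq (colour-z i))))
    separate i (inj₂ (inj₂ refl)) (inj₂ (inj₁ refl)) eq =
      ⊥-elim (next²-≢ _ (trans (sym (colour-v i)) (trans eq (colour-o i))))

  private
    x₀ = at zero
    x₁ = at (suc zero)
    x₂ = at (suc (suc zero))

  cover₃ : ∀ {u} → u ∈ S → u ≡ x₀ ⊎ u ≡ x₁ ⊎ u ≡ x₂
  cover₃ u∈ with covers u∈
  ... | zero           , eq = inj₁ (sym eq)
  ... | suc zero       , eq = inj₂ (inj₁ (sym eq))
  ... | suc (suc zero) , eq = inj₂ (inj₂ (sym eq))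

  trees : (choose : Fin ℓ → Bool) → (∀ {i j} → choose i ≡ choose j → i ≡ j) → RainbowTrees
  trees choose inj = go _ _ _ refl refl refl
    where
    one-sided : ∀ {c} → side x₀ ≡ c → side x₁ ≡ c → side x₂ ≡ c → ∀ v → v ∈ S → side v ≡ c
    one-sided s₀ s₁ s₂ v v∈ with cover₃ v∈
    ... | inj₁ refl        = s₀
    ... | inj₂ (inj₁ refl) = s₁
    ... | inj₂ (inj₂ refl) = s₂
    path = paths choose inj
    pair : ∀ {i j} → i ≢ j → at i ≢ at j
    pair i≢j eq = i≢j (at-injective eq)
    lone₀ : ∀ {u} → u ∈ S → u ≡ x₁ ⊎ u ≡ x₂ ⊎ u ≡ x₀
    lone₀ = [ inj₂ ∘ inj₂ , [ inj₁ , inj₂ ∘ inj₁ ]′ ]′ ∘ cover₃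
    lone₁ : ∀ {u} → u ∈ S → u ≡ x₀ ⊎ u ≡ x₂ ⊎ u ≡ x₁
    lone₁ = [ inj₁ , [ inj₂ ∘ inj₂ , inj₂ ∘ inj₁ ]′ ]′ ∘ cover₃
    path₀ : ∀ b → side x₀ ≡ b → side x₁ ≡ not b → side x₂ ≡ not b → RainbowTrees
    path₀ b s₀ s₁ s₂ = path b (at∈ _) (at∈ _) (at∈ _) (pair λ ()) s₁ s₂ s₀ lone₀
    path₁ : ∀ b → side x₀ ≡ not b → side x₁ ≡ b → side x₂ ≡ not b → RainbowTrees
    path₁ b s₀ s₁ s₂ = path b (at∈ _) (at∈ _) (at∈ _) (pair λ ()) s₀ s₂ s₁ lone₁
    path₂ : ∀ b → side x₀ ≡ not b → side x₁ ≡ not b → side x₂ ≡ b → RainbowTrees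
    path₂ b s₀ s₁ s₂ = path b (at∈ _) (at∈ _) (at∈ _) (pair λ ()) s₀ s₁ s₂ cover₃
    -- Unless all three terminals share a side, exactly one of them is alone on its side and takes
    -- the role of `v`.
    go : ∀ b₀ b₁ b₂ → side x₀ ≡ b₀ → side x₁ ≡ b₁ → side x₂ ≡ b₂ → RainbowTrees
    go true  true  true  s₀ s₁ s₂ = stars ≤-refl zero false (at∈ zero) (one-sided s₀ s₁ s₂)

    go false false false s₀ s₁ s₂ = stars ≤-refl zero true (at∈ zero) (one-sided s₀ s₁ s₂)

    go true  false false s₀ s₁ s₂ = path₀ true s₀ s₁ s₂
    go false true  true  s₀ s₁ s₂ = path₀ false s₀ s₁ s₂
    go false true  false s₀ s₁ s₂ = path₁ true s₀ s₁ s₂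
    go true  false true  s₀ s₁ s₂ = path₁ false s₀ s₁ s₂
    go false false true  s₀ s₁ s₂ = path₂ true s₀ s₁ s₂
    go true  true  false s₀ s₁ s₂ = path₂ false s₀ s₁ s₂

-- Growth

-- Upper cuts are closed upwards, so a negative element of the cut would put `0ℚ` above `x`.
rational-above : (x : ℝ) → ¬ (x ℝ<ℚ 0ℚ) →
                 ∃[ a ] ∃[ b ] Σ (NonZero b) λ nz → x ℝ<ℚ ((+ a / b) {{nz}})
rational-above x x≮0 with ℝ.U-inhabited x
... | q@(mkℚ (+ a) d _)    , x<q = a , suc d , _ , subst (x ℝ<ℚ_) (sym (↥p/↧p≡p q)) x<q
... | q@(mkℚ -[1+ a ] d _) , x<q =
  ⊥-elim (x≮0 (Equivalence.from (ℝ.U-rounded x 0ℚ) (q , negative⁻¹ q , x<q)))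

n≤n^q : ∀ n q .{{_ : NonZero q}} → n ≤ n ^ q
n≤n^q zero    q       = z≤n
n≤n^q (suc n) (suc q) = m≤m*n (suc n) (suc n ^ q) {{m^n≢0 (suc n) q}}

-- One choice of rationals above `C` and `α` suffices: `m ≤ b * m ≤ (b * m) ^ q ≤ a ^ q * n ^ p`.
polynomial-bound : (C α : ℝ) → 0ℚ ℚ<ℝ C → 1ℚ ℚ≤ℝ α →
                   ∃[ A ] ∃[ p ] (∀ m n → m ≤ C · n ^ℝ α → m ≤ A * n ^ p)
polynomial-bound C α 0<C 1≤α
  with a , b , b≢0 , C<a/b ← rational-above C (λ C<0 → ℝ.disjoint C 0ℚ (0<C , C<0))
     | p , q , q≢0 , α<p/q ← rational-above α
         (λ α<0 → 1≤α (Equivalence.from (ℝ.U-rounded α 1ℚ) (0ℚ , positive⁻¹ 1ℚ , α<0)))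
  = a ^ q , p , λ m n m≤ →
      ≤-trans (m≤n*m m b {{b≢0}}) (≤-trans (n≤n^q (b * m) q {{q≢0}}) (m≤ a b p q {{b≢0}} {{q≢0}} C<a/b α<p/q))

suc-n≤2^n : ∀ n → suc n ≤ 2 ^ n
suc-n≤2^n zero    = ≤-refl
suc-n≤2^n (suc n) = begin
  suc (suc n)       ≤⟨ s≤s (m≤n+m (suc n) n) ⟩
  suc (n + suc n)   ≡⟨ solve 1 (λ n → con 1 :+ (n :+ (con 1 :+ n)) := con 2 :* (con 1 :+ n)) refl n ⟩
  2 * suc n         ≤⟨ *-monoʳ-≤ 2 (suc-n≤2^n n) ⟩
  2 ^ suc n         ∎
  where
  open ≤-Reasoning
  open +-*-Solver

-- An upward search. The fuel bounds the distance from `h` to `n`; once `h` reaches `n`, the bound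
-- `h ≤ g h` rules out `g (suc h) ≤ n`.
between : (g : ℕ → ℕ) → (∀ h → h ≤ g h) → ∀ h₀ n → g h₀ ≤ n →
          ∃[ h ] (h₀ ≤ h × g h ≤ n × n < g (suc h))
between g h≤g h₀ n gh₀≤n = search n h₀ ≤-refl gh₀≤n (m≤n+m n h₀)
  where
  search : ∀ fuel h → h₀ ≤ h → g h ≤ n → n ≤ h + fuel → ∃[ h ] (h₀ ≤ h × g h ≤ n × n < g (suc h))
  search fuel h h₀≤h gh≤n n≤ with g (suc h) ≤? n
  ... | no ≰ = h , h₀≤h , gh≤n , ≰⇒> ≰
  search zero h h₀≤h gh≤n n≤ | yes g≤n =
    ⊥-elim (<-irrefl refl (≤-trans (h≤g (suc h)) (≤-trans g≤n (subst (n ≤_) (+-identityʳ h) n≤))))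
  search (suc fuel) h h₀≤h gh≤n n≤ | yes g≤n =
    search fuel (suc h) (m≤n⇒m≤1+n h₀≤h) g≤n (subst (n ≤_) (+-suc h fuel) n≤)

^-distribʳ-* : ∀ a b e → (a * b) ^ e ≡ a ^ e * b ^ e
^-distribʳ-* a b zero    = refl
^-distribʳ-* a b (suc e) = trans (cong (a * b *_) (^-distribʳ-* a b e))
  (solve 4 (λ a b x y → a :* b :* (x :* y) := a :* x :* (b :* y)) refl a b (a ^ e) (b ^ e))
  where open +-*-Solver

-- D = (r p + 1) h for the largest h with D ^ r B ≤ n; then n is less than
-- const (h + 1) ^ r ≤ const 2 ^ (h r), and h ≥ const leaves room for the constants.
dimension : ∀ A p r B .{{_ : NonZero r}} .{{_ : NonZero B}} →
            ∃[ N ] (∀ m n → n ≤ m → m ≤ A * n ^ p → N ≤ n →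
              ∃[ D ] (0 < D × D ^ r * B ≤ n × m + n ≤ 2 ^ D))
dimension A p r B = g h₀ , large
  where
  Q c h₀ : ℕ
  Q  = suc (r * p)
  c  = 2 * (A * (Q ^ r * B) ^ p)
  h₀ = suc c
  g : ℕ → ℕ
  g h = (Q * h) ^ r * B
  h≤g : ∀ h → h ≤ g h
  h≤g h = ≤-trans (m≤n*m h Q) (≤-trans (n≤n^q (Q * h) r) (m≤m*n _ B))
  g-pow : ∀ h → g (suc h) ^ p ≡ (Q ^ r * B) ^ p * suc h ^ (r * p)
  g-pow h = trans (cong (_^ p) rearrange)
    (trans (^-distribʳ-* (Q ^ r * B) (suc h ^ r) p) (cong ((Q ^ r * B) ^ p *_) (^-*-assoc (suc h) r p)))
    where
    open +-*-Solver
    rearrange : g (suc h) ≡ Q ^ r * B * suc h ^ r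
    rearrange = trans (cong (_* B) (^-distribʳ-* Q (suc h) r))
      (solve 3 (λ x y z → x :* y :* z := x :* z :* y) refl (Q ^ r) (suc h ^ r) B)
  large : ∀ m n → n ≤ m → m ≤ A * n ^ p → g h₀ ≤ n → ∃[ D ] (0 < D × D ^ r * B ≤ n × m + n ≤ 2 ^ D)
  large m n n≤m m≤ N≤n with h , h₀≤h , g≤n , n<g ← between g h≤g h₀ n N≤n =
    Q * h , ≤-trans (≤-trans (s≤s z≤n) h₀≤h) (m≤n*m h Q) , g≤n , (begin
      m + n                                        ≤⟨ +-monoʳ-≤ m n≤m ⟩
      m + m                                        ≡⟨ cong (λ x → m + x) (+-identityʳ m) ⟨
      2 * m                                        ≤⟨ *-monoʳ-≤ 2 m≤ ⟩
      2 * (A * n ^ p)                              ≤⟨ *-monoʳ-≤ 2 (*-monoʳ-≤ A (^-monoˡ-≤ p (<⇒≤ n<g))) ⟩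
      2 * (A * g (suc h) ^ p)                      ≡⟨ cong (λ x → 2 * (A * x)) (g-pow h) ⟩
      2 * (A * ((Q ^ r * B) ^ p * suc h ^ (r * p)))  ≡⟨ assoc A ((Q ^ r * B) ^ p) (suc h ^ (r * p)) ⟩
      c * suc h ^ (r * p)                          ≤⟨ *-mono-≤ c≤2^h (^-monoˡ-≤ (r * p) (suc-n≤2^n h)) ⟩
      -- By the choice of `Q` as `r * p + 1`, this product is `(2 ^ h) ^ Q`.
      2 ^ h * (2 ^ h) ^ (r * p)                    ≡⟨ ^-*-assoc 2 h Q ⟩
      2 ^ (h * Q)                                  ≡⟨ cong (2 ^_) (*-comm h Q) ⟩
      2 ^ (Q * h)                                  ∎)
    where
    open ≤-Reasoning
    c≤2^h : c ≤ 2 ^ h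
    c≤2^h = ≤-trans (n≤1+n c) (≤-trans h₀≤h (≤-trans (n≤1+n h) (suc-n≤2^n h)))
    assoc : ∀ a b d → 2 * (a * (b * d)) ≡ 2 * (a * b) * d
    assoc = solve 3 (λ a b d → con 2 :* (a :* (b :* d)) := con 2 :* (a :* b) :* d) refl
      where open +-*-Solver

-- Opaque, since its threshold is astronomical already for t = 3 and κ = 4.
opaque
  universal-colouring : ∀ A p t ℓ κ .{{_ : NonZero t}} .{{_ : NonZero ℓ}} .{{_ : NonZero κ}} →
    ∃[ N ] (∀ m n → n ≤ m → m ≤ A * n ^ p → N ≤ n → UniversalColouring m n t κ ℓ)
  universal-colouring A p (suc t) (suc ℓ) (suc κ) =
    proj₁ (dimension A p r B) , λ m n n≤m m≤ N≤n →
      construct m n n≤m (proj₂ (dimension A p r B) m n n≤m m≤ N≤n)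
    where
    k r M B : ℕ
    k = suc κ
    r = k * k
    M = suc (k * suc k)
    B = suc ℓ * (M * (M ^ k * suc t ^ (2 ^ r)))
    instance
      tables≢0 : NonZero (suc t ^ (2 ^ r))
      tables≢0 = m^n≢0 (suc t) (2 ^ r)
      lists≢0 : NonZero (M ^ k)
      lists≢0 = m^n≢0 M k
      rest≢0 : NonZero (M ^ k * suc t ^ (2 ^ r))
      rest≢0 = m*n≢0 (M ^ k) (suc t ^ (2 ^ r))
      B≢0 : NonZero B
      B≢0 = m*n≢0 (suc ℓ) (M * (M ^ k * suc t ^ (2 ^ r))) {{_}} {{m*n≢0 M (M ^ k * suc t ^ (2 ^ r))}}
    construct : ∀ m n → n ≤ m → ∃[ D ] (0 < D × D ^ r * B ≤ n × m + n ≤ 2 ^ D) →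
                UniversalColouring m n (suc t) k (suc ℓ)
    -- A positive dimension supplies the default position, and a positive number of colours the
    -- default colour.
    construct m n n≤m (suc D , _ , size≤n , fits) = record
      { cc     = cc size≤m size≤n
      ; cc-sym = cc-sym size≤m size≤n
      ; copy   = λ v → copy (code size≤m size≤n v)
      ; extend = universal size≤m size≤n
      }
      where
      open CodeColouring m n (suc t) (suc ℓ) k (suc D) zero zero fits
        using (size; cc; cc-sym; copy; code; universal)
      size≤m : size ≤ m
      size≤m = ≤-trans size≤n n≤m
      instance
        size≢0 : NonZero size
        size≢0 = m*n≢0 (suc D ^ r) B {{m^n≢0 (suc D) r}}

-- Lower bounds

∣⁅x⁆∪p∣≡1+∣p∣ : ∀ {n} {x : Fin n} (p : Subset n) → x ∉ p → ∣ ⁅ x ⁆ ∪ p ∣ ≡ suc ∣ p ∣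
∣⁅x⁆∪p∣≡1+∣p∣ {x = zero}  (outside ∷ p) _   = cong (suc ∘ ∣_∣) (∪-identityˡ p)
∣⁅x⁆∪p∣≡1+∣p∣ {x = zero}  (inside ∷ p)  x∉p = ⊥-elim (x∉p here)
∣⁅x⁆∪p∣≡1+∣p∣ {x = suc x} (outside ∷ p) x∉p = ∣⁅x⁆∪p∣≡1+∣p∣ p (x∉p ∘ there)
∣⁅x⁆∪p∣≡1+∣p∣ {x = suc x} (inside ∷ p)  x∉p = cong suc (∣⁅x⁆∪p∣≡1+∣p∣ p (x∉p ∘ there))

∈-insert⁻ : ∀ {n} {x y : Fin n} p → y ∈ ⁅ x ⁆ ∪ p → y ≡ x ⊎ y ∈ p
∈-insert⁻ {x = x} p y∈ with x∈p∪q⁻ ⁅ x ⁆ p y∈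
... | inj₁ y∈x = inj₁ (x∈⁅y⁆⇒x≡y x y∈x)
... | inj₂ y∈p = inj₂ y∈p

insert-⊆ : ∀ {n} {x : Fin n} {p q} → x ∈ q → p ⊆ q → ⁅ x ⁆ ∪ p ⊆ q
insert-⊆ {p = p} x∈q p⊆q y∈ with ∈-insert⁻ p y∈
... | inj₁ refl = x∈q
... | inj₂ y∈p  = p⊆q y∈p

fromList : ∀ {n} → List (Fin n) → Subset n
fromList []       = ∅
fromList (x ∷ xs) = ⁅ x ⁆ ∪ fromList xs

∈-fromList⁺ : ∀ {n} {x : Fin n} {xs} → x ∈ˡ xs → x ∈ fromList xs
∈-fromList⁺ {x = x} (Any.here refl) = x∈p∪q⁺ (inj₁ (x∈⁅x⁆ x))
∈-fromList⁺ {xs = y ∷ _} (Any.there x∈) = x∈p∪q⁺ {p = ⁅ y ⁆} (inj₂ (∈-fromList⁺ x∈))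

∈-fromList⁻ : ∀ {n} {x : Fin n} xs → x ∈ fromList xs → x ∈ˡ xs
∈-fromList⁻ []       x∈ = ⊥-elim (∉⊥ x∈)
∈-fromList⁻ (y ∷ xs) x∈ with ∈-insert⁻ (fromList xs) x∈
... | inj₁ eq  = Any.here eq
... | inj₂ x∈′ = Any.there (∈-fromList⁻ xs x∈′)

∣fromList∣ : ∀ {n} {xs : List (Fin n)} → Unique xs → ∣ fromList xs ∣ ≡ length xs
∣fromList∣ {n} []             = ∣⊥∣≡0 n
∣fromList∣ {xs = x ∷ xs} u@(_ ∷ us) =
  trans (∣⁅x⁆∪p∣≡1+∣p∣ (fromList xs) (Uniqueₚ.Unique[x∷xs]⇒x∉xs u ∘ ∈-fromList⁻ xs)) (cong suc (∣fromList∣ us))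

module _ {A : Set} {P : A → Set} (P? : Decidable P) where

  length-filter-¬ : ∀ xs → length (filter P? xs) + length (filter (¬? ∘ P?) xs) ≡ length xs
  length-filter-¬ []       = refl
  length-filter-¬ (x ∷ xs) with P? x
  ... | yes _ = cong suc (length-filter-¬ xs)
  ... | no _  = trans (+-suc _ _) (cong suc (length-filter-¬ xs))

-- Induction on the number of values: either the top value is taken `b` times, or dropping its fibre
-- loses fewer than `b` entries.
large-fibre : ∀ {A : Set} (f : A → ℕ) c b xs → Unique xs → All (λ x → f x < c) xs → c * b < length xs →
              ∃[ y ] ∃[ ys ] (Unique ys × length ys ≡ b × All (λ x → f x ≡ y) ys)
large-fibre f zero    b (x ∷ xs) _ (() ∷ _) _
large-fibre f (suc c) b xs u f< big with b ≤? length (filter (λ x → f x ℕ.≟ c) xs)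
... | yes b≤ = c , take b (filter at-c xs) , Uniqueₚ.take⁺ b (Uniqueₚ.filter⁺ at-c u)
    , trans (length-take b _) (m≤n⇒m⊓n≡m b≤) , Allₚ.take⁺ b (Allₚ.all-filter at-c xs)
  where at-c = λ x → f x ℕ.≟ c
... | no b≰ = large-fibre f c b (filter (¬? ∘ at-c) xs) (Uniqueₚ.filter⁺ (¬? ∘ at-c) u)
    (All.zipWith (λ (lt , ne) → ≤∧≢⇒< (≤-pred lt) ne)
      (Allₚ.filter⁺ (¬? ∘ at-c) f< , Allₚ.all-filter (¬? ∘ at-c) xs))
    (+-cancelˡ-< b _ _ (begin-strict
      b + c * b                                            <⟨ big ⟩
      length xs                                            ≡⟨ length-filter-¬ at-c xs ⟨
      length (filter at-c xs) + length (filter (¬? ∘ at-c) xs) ≤⟨ +-monoˡ-≤ _ (<⇒≤ (≰⇒> b≰)) ⟩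
      b + length (filter (¬? ∘ at-c) xs)                   ∎))
  where
  at-c = λ x → f x ℕ.≟ c
  open ≤-Reasoning

exit : ∀ {n} {R : Fin n → Fin n → Set} {a b} (P : Subset n) → Star R a b → a ∈ P → b ∉ P →
       ∃[ u ] ∃[ v ] (R u v × u ∈ P × v ∉ P)
exit P ε a∈ b∉ = ⊥-elim (b∉ a∈)
exit P (_◅_ {j = v} e es) a∈ b∉ with v ∈? P
... | yes v∈ = exit P es v∈ b∉
... | no v∉  = _ , _ , e , a∈ , v∉

-- The size of connected rainbow subgraphs

module _ {G : Graph} {t : ℕ} (c : EdgeColouring G t) (H : Subgraph G) where

  open Graph G using (Vertex; order)
  open Subgraph H
  open EdgeColouring c

  neighbour : Connected H → ∀ {u v} → u ∈ V → v ∈ V → u ≢ v → ∃[ x ] E u x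
  neighbour conn u∈ v∈ u≢v with conn u∈ v∈
  ... | ε     = ⊥-elim (u≢v refl)
  ... | e ◅ _ = _ , e

  -- Grow a set P of vertices along edges leaving it: each new edge has a new colour.
  rainbow-size : Connected H → IsRainbow c H → ∣ V ∣ ≤ suc t
  rainbow-size conn rb with any? (_∈? V)
  ... | no empty      = ≤-trans (p⊆q⇒∣p∣≤∣q∣ {p = V} {q = ∅} λ x∈ → ⊥-elim (empty (_ , x∈)))
                          (≤-trans (≤-reflexive (∣⊥∣≡0 order)) z≤n)
  ... | yes (r , r∈V) = grow order ⁅ r ⁆ ∅ (x∈⁅x⁆ r)
        (trans (∣⁅x⁆∣≡1 r) (cong suc (sym (∣⊥∣≡0 t)))) (λ q∈ → ⊥-elim (∉⊥ q∈)) (m≤m+n order _)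
    where
    -- Invariant of the growth: `P` has one vertex more than `Q` has colours, and each colour of `Q`
    -- occurs on an edge within `P`.
    Inside : Subset order → Fin t → Set
    Inside P q = ∃[ u ] ∃[ v ] Σ (E u v) λ e → u ∈ P × v ∈ P × colour (E⇒~ e) ≡ q
    grow : ∀ fuel P Q → r ∈ P → ∣ P ∣ ≡ suc ∣ Q ∣ → (∀ {q} → q ∈ Q → Inside P q) →
           order ≤ fuel + ∣ P ∣ → ∣ V ∣ ≤ suc t
    grow fuel P Q r∈P size inP enough with any? (λ x → (x ∈? V) ×-dec ¬? (x ∈? P))
    ... | no none = begin
        ∣ V ∣      ≤⟨ p⊆q⇒∣p∣≤∣q∣ V⊆P ⟩
        ∣ P ∣      ≡⟨ size ⟩
        suc ∣ Q ∣  ≤⟨ s≤s (∣p∣≤n Q) ⟩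
        suc t      ∎
      where
      open ≤-Reasoning
      V⊆P : V ⊆ P
      V⊆P {x} x∈V with x ∈? P
      ... | yes x∈P = x∈P
      ... | no x∉P  = ⊥-elim (none (x , x∈V , x∉P))
    -- Here `P` already has at least `order` elements, so the bound on its size also bounds `V`.
    grow zero P Q r∈P size inP enough | yes _ = ≤-trans (∣p∣≤n V) (≤-trans enough
      (subst (_≤ suc t) (sym size) (s≤s (∣p∣≤n Q))))
    grow (suc fuel) P Q r∈P size inP enough | yes (x , x∈V , x∉P)
      with u , v , e , u∈P , v∉P ← exit P (conn r∈V x∈V) r∈P x∉P =
      grow fuel (⁅ v ⁆ ∪ P) (⁅ q ⁆ ∪ Q) (old r∈P)
        (trans (∣⁅x⁆∪p∣≡1+∣p∣ P v∉P) (cong suc (trans size (sym (∣⁅x⁆∪p∣≡1+∣p∣ Q q∉Q))))) inP′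
        (≤-trans enough (≤-reflexive (trans (sym (+-suc fuel _)) (cong (λ s → fuel + s) (sym (∣⁅x⁆∪p∣≡1+∣p∣ P v∉P))))))
      where
      q = colour (E⇒~ e)
      old : P ⊆ ⁅ v ⁆ ∪ P
      old y∈ = x∈p∪q⁺ {p = ⁅ v ⁆} (inj₂ y∈)
      -- An edge within `P` of this colour would have to be the edge just found, whose end `v` is
      -- not in `P`.
      q∉Q : q ∉ Q
      q∉Q q∈ with inP q∈
      ... | a , b , f , a∈ , b∈ , eq with rb f e eq
      ...   | inj₁ (_ , refl) = v∉P b∈
      ...   | inj₂ (refl , _) = v∉P a∈
      inP′ : ∀ {q′} → q′ ∈ ⁅ q ⁆ ∪ Q → Inside (⁅ v ⁆ ∪ P) q′
      inP′ q′∈ with ∈-insert⁻ Q q′∈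
      ... | inj₁ refl = u , v , e , old u∈P , x∈p∪q⁺ (inj₁ (x∈⁅x⁆ v)) , refl
      ... | inj₂ q′∈Q with a , b , f , a∈ , b∈ , eq ← inP q′∈Q = a , b , f , old a∈ , old b∈ , eq

  -- Otherwise there would be at least `∣ S ∣ + 2` vertices, while `rainbow-size` allows `t + 1`,
  -- which is at most `∣ S ∣ + 1`.
  unique-outsider : ∀ {S} → Connected H → IsRainbow c H → S ⊆ V → t ≤ ∣ S ∣ →
                    ∀ {x y} → x ∈ V → x ∉ S → y ∈ V → y ∉ S → x ≡ y
  unique-outsider {S} conn rb S⊆V t≤ {x} {y} x∈ x∉ y∈ y∉ with x ≟ y
  ... | yes eq = eq
  ... | no x≢y = ⊥-elim (<-irrefl refl (begin-strict
      suc ∣ S ∣                     <⟨ n<1+n _ ⟩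
      suc (suc ∣ S ∣)               ≡⟨ cong suc (∣⁅x⁆∪p∣≡1+∣p∣ S y∉) ⟨
      suc ∣ ⁅ y ⁆ ∪ S ∣             ≡⟨ ∣⁅x⁆∪p∣≡1+∣p∣ (⁅ y ⁆ ∪ S) ([ x≢y , x∉ ]′ ∘ ∈-insert⁻ S) ⟨
      ∣ ⁅ x ⁆ ∪ (⁅ y ⁆ ∪ S) ∣       ≤⟨ p⊆q⇒∣p∣≤∣q∣ (insert-⊆ x∈ (insert-⊆ y∈ S⊆V)) ⟩
      ∣ V ∣                         ≤⟨ rainbow-size conn rb ⟩
      suc t                         ≤⟨ s≤s t≤ ⟩
      suc ∣ S ∣                     ∎))
    where open ≤-Reasoning

-- Terminal sets that force many colours

module LowerBounds (m n : ℕ) where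

  open Bipartite m n
  open Graph G using (Vertex; _~_)

  left : Fin m → Vertex
  left i = i ↑ˡ n

  right : Fin n → Vertex
  right j = m ↑ʳ j

  left-injective : ∀ {i j} → left i ≡ left j → i ≡ j
  left-injective = ↑ˡ-injective n _ _

  right-injective : ∀ {i j} → right i ≡ right j → i ≡ j
  right-injective = ↑ʳ-injective m _ _

  left~right : ∀ i j → left i ~ right j
  left~right i j = opposite⇒~ (trans (side-↑ˡ i) (cong not (sym (side-↑ʳ j))))

  left≢right : ∀ {u v} → side u ≡ true → side v ≡ false → u ≢ v
  left≢right p q refl with () ← trans (sym p) q

  ~true : ∀ {u v} → u ~ v → side u ≡ true → side v ≡ false
  ~true {u} {v} u~v su with side v | trans (sym su) (~⇒opposite {u} {v} u~v)
  ... | false | _ = refl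

  ~false : ∀ {u v} → u ~ v → side u ≡ false → side v ≡ true
  ~false {u} {v} u~v su with side v | trans (sym su) (~⇒opposite {u} {v} u~v)
  ... | true | _ = refl

  colour-irrelevant : ∀ {t} (c : EdgeColouring G t) {u v} (e e′ : u ~ v) →
                      EdgeColouring.colour c e ≡ EdgeColouring.colour c e′
  colour-irrelevant c e e′ = cong (EdgeColouring.colour c) (T-irrelevant e e′)

  module _ {t ℓ : ℕ} (c : EdgeColouring G t) where

    open EdgeColouring c

    Trees : ℕ → Set
    Trees k = IsRainbowColouring k ℓ c

    module AtTree {k} (trees : Trees k) (xs : List Vertex) (unique : Unique xs) (length≡k : length xs ≡ k) where

      S : Subset (m + n)
      S = fromList xs

      ∣S∣≡k : ∣ S ∣ ≡ k
      ∣S∣≡k = trans (∣fromList∣ unique) length≡k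

      Ts : Fin ℓ → Subgraph G
      Ts = proj₁ (trees S ∣S∣≡k)

      disjoint : InternallyDisjoint S Ts
      disjoint = proj₂ (proj₂ (trees S ∣S∣≡k))

      module _ (i : Fin ℓ) where

        private
          connecting = proj₁ (proj₂ (trees S ∣S∣≡k)) i

        rainbow : IsRainbow c (Ts i)
        rainbow = proj₂ (proj₂ connecting)

        connected : Connected (Ts i)
        connected = proj₁ (proj₂ (proj₁ connecting))

        S⊆V : S ⊆ Subgraph.V (Ts i)
        S⊆V = proj₁ (proj₂ connecting)

        xs⊆V : ∀ {x} → x ∈ˡ xs → x ∈ Subgraph.V (Ts i)
        xs⊆V x∈ = S⊆V (∈-fromList⁺ x∈)

        joined : ∀ {u v} → u ∈ˡ xs → v ∈ˡ xs → u ≢ v → ∃[ x ] Subgraph.E (Ts i) u x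
        joined u∈ v∈ = neighbour c (Ts i) connected (xs⊆V u∈) (xs⊆V v∈)

        E⇒end∈V : ∀ {u v} → Subgraph.E (Ts i) u v → v ∈ Subgraph.V (Ts i)
        E⇒end∈V e = Subgraph.E⇒∈V (Ts i) (Subgraph.E-sym (Ts i) e)

        one-outsider : t ≤ k → ∀ {x y} → x ∈ Subgraph.V (Ts i) → ¬ (x ∈ˡ xs) →
                       y ∈ Subgraph.V (Ts i) → ¬ (y ∈ˡ xs) → x ≡ y
        one-outsider t≤k x∈ x∉ y∈ y∉ =
          unique-outsider c (Ts i) connected rainbow S⊆V (subst (t ≤_) (sym ∣S∣≡k) t≤k)
            x∈ (x∉ ∘ ∈-fromList⁻ xs) y∈ (y∉ ∘ ∈-fromList⁻ xs)

    -- A tree joining three left vertices also has a right vertex, hence at least four vertices,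
    -- whereas two colours allow three.
    two-colours : 3 ≤ m → 0 < ℓ → t ≤ 2 → ¬ Trees 3
    two-colours 3≤m 0<ℓ t≤2 trees = absurd (joined i (Any.here refl) (Any.there (Any.here refl)) l₀≢l₁)
      where
      l : Fin 3 → Vertex
      l i = left (inject≤ i 3≤m)
      l-injective : ∀ {i j} → l i ≡ l j → i ≡ j
      l-injective eq = inject≤-injective 3≤m 3≤m _ _ (left-injective eq)
      l₀≢l₁ : l zero ≢ l (suc zero)
      l₀≢l₁ eq with () ← l-injective eq
      xs = map l (allFin 3)
      open AtTree trees xs (Uniqueₚ.map⁺ l-injective (Uniqueₚ.allFin⁺ 3)) refl
      i = fromℕ< 0<ℓ
      absurd : ¬ (∃[ x ] Subgraph.E (Ts i) (l zero) x)
      absurd (x , e) = <-irrefl refl (begin-strict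
        3                                     <⟨ n<1+n 3 ⟩
        4                                     ≡⟨ cong suc ∣S∣≡k ⟨
        suc ∣ S ∣                             ≡⟨ ∣⁅x⁆∪p∣≡1+∣p∣ S x∉S ⟨
        ∣ ⁅ x ⁆ ∪ S ∣                         ≤⟨ p⊆q⇒∣p∣≤∣q∣ (insert-⊆ (E⇒end∈V i e) (S⊆V i)) ⟩
        ∣ Subgraph.V (Ts i) ∣                 ≤⟨ rainbow-size c (Ts i) (connected i) (rainbow i) ⟩
        suc t                                 ≤⟨ s≤s t≤2 ⟩
        3                                     ∎)
        where
        open ≤-Reasoning
        x∉S : x ∉ S
        x∉S x∈ with j , _ , eq ← ∈-map⁻ l (∈-fromList⁻ xs x∈) =
          left≢right (side-↑ˡ (inject≤ j 3≤m)) (~true (Subgraph.E⇒~ (Ts i) e) (side-↑ˡ (inject≤ zero 3≤m))) (sym eq)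

    -- In a tree without the edges `vp` and `vq`, a neighbour of `v` and one of `p` would be
    -- outsiders on opposite sides, but only one outsider is possible. So each tree uses one of two
    -- edges, and three trees cannot be edge-disjoint.
    three-colours : 2 ≤ m → 1 ≤ n → 3 ≤ ℓ → t ≤ 3 → ¬ Trees 3
    three-colours 2≤m 1≤n 3≤ℓ t≤3 trees = absurd (pigeonhole 3≤ℓ (λ i → pick (T? (v-p i))))
      where
      p q v : Vertex
      p = left (inject≤ zero 2≤m)
      q = left (inject≤ (suc zero) 2≤m)
      v = right (inject≤ zero 1≤n)
      p-left = side-↑ˡ (inject≤ zero 2≤m)
      q-left = side-↑ˡ (inject≤ (suc zero) 2≤m)
      v-right = side-↑ʳ (inject≤ zero 1≤n)
      p≢q : p ≢ q
      p≢q eq with () ← inject≤-injective 2≤m 2≤m zero (suc zero) (left-injective eq)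
      p≢v = left≢right p-left v-right
      q≢v = left≢right q-left v-right
      xs = p ∷ q ∷ v ∷ []
      open AtTree trees xs ((p≢q ∷ p≢v ∷ []) ∷ (q≢v ∷ []) ∷ [] ∷ []) refl
      v-p : Fin ℓ → Bool
      v-p i = Subgraph.edge (Ts i) v p
      pick : ∀ {A : Set} → Dec A → Fin 2
      pick (yes _) = zero
      pick (no _)  = suc zero
      v∈xs : v ∈ˡ xs
      v∈xs = Any.there (Any.there (Any.here refl))
      right∉xs : ∀ {x} → side x ≡ false → x ≢ v → ¬ (x ∈ˡ xs)
      right∉xs s x≢v (Any.here refl)                         = left≢right p-left s refl
      right∉xs s x≢v (Any.there (Any.here refl))             = left≢right q-left s refl
      right∉xs s x≢v (Any.there (Any.there (Any.here refl))) = x≢v refl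
      left∉xs : ∀ {x} → side x ≡ true → x ≢ p → x ≢ q → ¬ (x ∈ˡ xs)
      left∉xs s x≢p x≢q (Any.here eq)                          = x≢p eq
      left∉xs s x≢p x≢q (Any.there (Any.here eq))              = x≢q eq
      left∉xs s x≢p x≢q (Any.there (Any.there (Any.here refl))) = left≢right s v-right refl
      v-q : ∀ i → ¬ T (v-p i) → Subgraph.E (Ts i) v q
      v-q i ¬vp with joined i v∈xs (Any.here refl) (p≢v ∘ sym) | joined i (Any.here refl) v∈xs p≢v
      ... | y , vy | x , px with y ≟ q
      ...   | yes refl = vy
      ...   | no y≢q   = ⊥-elim (left≢right y-left x-right (sym (one-outsider i t≤3
                (E⇒end∈V i px) (right∉xs x-right λ { refl → ¬vp (Subgraph.E-sym (Ts i) px) })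
                (E⇒end∈V i vy) (left∉xs y-left (λ { refl → ¬vp vy }) y≢q))))
        where
        y-left  = ~false (Subgraph.E⇒~ (Ts i) vy) v-right
        x-right = ~true (Subgraph.E⇒~ (Ts i) px) p-left
      absurd : ¬ (∃[ i ] ∃[ j ] (toℕ i < toℕ j × pick (T? (v-p i)) ≡ pick (T? (v-p j))))
      absurd (i , j , i<j , eq) with T? (v-p i) | T? (v-p j) | eq
      ... | yes a | yes b | _ = proj₁ (disjoint i j (<⇒≢ i<j)) v p (a , b)
      ... | no a  | no b  | _ = proj₁ (disjoint i j (<⇒≢ i<j)) v q (v-q i a , v-q j b)

    edge-colour : Fin m → Fin n → Fin t
    edge-colour i j = colour (left~right i j)

    -- By the pigeonhole principle every right vertex sees two of the vertices lefts in one
    -- colour, and many right vertices agree on the pair and the colour.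
    module _ {s} (lefts : Fin s → Fin m) (lefts-injective : ∀ {i j} → lefts i ≡ lefts j → i ≡ j)
             (t<s : t < s) where

      clash : ∀ j → ∃[ i ] ∃[ i′ ] (toℕ i < toℕ i′ × edge-colour (lefts i) j ≡ edge-colour (lefts i′) j)
      clash j = pigeonhole t<s (λ i → edge-colour (lefts i) j)

      first second : Fin n → Fin s
      first j  = proj₁ (clash j)
      second j = proj₁ (proj₂ (clash j))

      shade : Fin n → Fin t
      shade j = edge-colour (lefts (first j)) j

      triple : Fin n → Fin (s * (s * t))
      triple j = combine (first j) (combine (second j) (shade j))

      monochromatic : ∀ b → s * (s * t) * suc b < n →
        ∃[ p ] ∃[ q ] ∃[ γ ] ∃[ ys ] (p ≢ q × Unique ys × length ys ≡ suc b ×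
          All (λ j → edge-colour p j ≡ γ × edge-colour q j ≡ γ) ys)
      monochromatic b big
        with large-fibre (toℕ ∘ triple) (s * (s * t)) (suc b) (allFin n) (Uniqueₚ.allFin⁺ n)
               (All.universal (λ j → toℕ<n (triple j)) _)
               (subst (s * (s * t) * suc b <_) (sym (length-tabulate id)) big)
      -- Matching the head with `refl` identifies the value common to the fibre with the triple of
      -- `j₀`.
      ... | _ , ys@(j₀ ∷ _) , unique , length≡ , same@(refl ∷ _) =
        lefts (first j₀) , lefts (second j₀) , shade j₀ , ys
        , <⇒≢ (proj₁ (proj₂ (proj₂ (clash j₀)))) ∘ lefts-injective
        , unique , length≡ , All.map (agree ∘ toℕ-injective) same
        where
        agree : ∀ {j} → triple j ≡ triple j₀ →
                edge-colour (lefts (first j₀)) j ≡ shade j₀ × edge-colour (lefts (second j₀)) j ≡ shade j₀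
        agree {j} eq =
            trans (cong (λ i → edge-colour (lefts i) j) (sym first≡)) shade≡
          , trans (cong (λ i → edge-colour (lefts i) j) (sym second≡))
              (trans (sym (proj₂ (proj₂ (proj₂ (clash j))))) shade≡)
          where
          first≡  = combine-injectiveˡ (first j) _ (first j₀) _ eq
          rest≡   = combine-injectiveʳ (first j) _ (first j₀) _ eq
          second≡ = combine-injectiveˡ (second j) (shade j) (second j₀) (shade j₀) rest≡
          shade≡  = combine-injectiveʳ (second j) (shade j) (second j₀) (shade j₀) rest≡

    -- If `p` and `q` had only terminals as neighbours in a tree, two of its edges would have colour
    -- `γ`; so there is an outsider on the right. The same argument at `j₁` and `j₂` gives one on
    -- the left, and `t ≤ k` forbids having both.
    k-colours : ∀ b → let k = 4 + b in 5 + b ≤ m → suc k * (suc k * t) * (2 + b) < n →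
                0 < ℓ → t ≤ k → ¬ Trees k
    k-colours b k<m big 0<ℓ t≤k trees
      -- The `suc k` left vertices outnumber the colours, and `2 + b` right vertices complete the
      -- pair to `k` terminals.
      with p , q , γ , j₁ ∷ j₂ ∷ js , p≢q , unique@((j₁≢j₂ ∷ _) ∷ _) , length≡ , same ←
             monochromatic (λ i → inject≤ i k<m) (inject≤-injective k<m k<m _ _) (s≤s t≤k) (suc b) big =
      absurd (joined i p∈ q∈ lp≢lq) (joined i q∈ p∈ (lp≢lq ∘ sym))
             (joined i j₁∈ j₂∈ rj≢) (joined i j₂∈ j₁∈ (rj≢ ∘ sym))
      where
      rights = map right (j₁ ∷ j₂ ∷ js)
      xs = left p ∷ left q ∷ rights
      left∉rights : ∀ i → All (left i ≢_) rights
      left∉rights i = Allₚ.map⁺ (All.universal (λ j → left≢right (side-↑ˡ i) (side-↑ʳ j)) _)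
      lp≢lq : left p ≢ left q
      lp≢lq = p≢q ∘ left-injective
      rj≢ : right j₁ ≢ right j₂
      rj≢ = j₁≢j₂ ∘ right-injective
      open AtTree trees xs
        ((lp≢lq ∷ left∉rights p) ∷ left∉rights q ∷ Uniqueₚ.map⁺ right-injective unique)
        (cong (λ s → 2 + s) (trans (length-map right (j₁ ∷ j₂ ∷ js)) length≡))
      i = fromℕ< 0<ℓ
      p∈ : left p ∈ˡ xs
      p∈ = Any.here refl
      q∈ : left q ∈ˡ xs
      q∈ = Any.there (Any.here refl)
      j₁∈ : right j₁ ∈ˡ xs
      j₁∈ = Any.there (Any.there (Any.here refl))
      j₂∈ : right j₂ ∈ˡ xs
      j₂∈ = Any.there (Any.there (Any.there (Any.here refl)))
      open Subgraph (Ts i) using () renaming (E to _—_; E⇒~ to —⇒~; E-sym to —-sym)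
      mono : ∀ {u j} (e : u — right j) → u ≡ left p ⊎ u ≡ left q → j ∈ˡ j₁ ∷ j₂ ∷ js →
             colour (—⇒~ e) ≡ γ
      mono e (inj₁ refl) j∈ = trans (colour-irrelevant c _ _) (proj₁ (All.lookup same j∈))
      mono e (inj₂ refl) j∈ = trans (colour-irrelevant c _ _) (proj₂ (All.lookup same j∈))
      left∈ : ∀ {x} → side x ≡ true → x ∈ˡ xs → x ≡ left p ⊎ x ≡ left q
      left∈ s (Any.here eq)             = inj₁ eq
      left∈ s (Any.there (Any.here eq)) = inj₂ eq
      left∈ s (Any.there (Any.there x∈)) with j , _ , refl ← ∈-map⁻ right x∈ =
        ⊥-elim (left≢right s (side-↑ʳ j) refl)
      right∈ : ∀ {x} → side x ≡ false → x ∈ˡ xs → ∃[ j ] (j ∈ˡ j₁ ∷ j₂ ∷ js × x ≡ right j)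
      right∈ s (Any.here refl)             = ⊥-elim (left≢right (side-↑ˡ p) s refl)
      right∈ s (Any.there (Any.here refl)) = ⊥-elim (left≢right (side-↑ˡ q) s refl)
      right∈ s (Any.there (Any.there x∈))  = ∈-map⁻ right x∈
      _∈xs? : ∀ x → Dec (x ∈ˡ xs)
      x ∈xs? = Any.any? (x ≟_) xs
      Outsider : Bool → Set
      Outsider b = ∃[ x ] (side x ≡ b × x ∈ Subgraph.V (Ts i) × ¬ (x ∈ˡ xs))
      right-outsider : (∃[ x ] left p — x) → (∃[ y ] left q — y) → Outsider false
      right-outsider (x , px) (y , qy) with x ∈xs? | y ∈xs?
      ... | no x∉  | _     = x , ~true (—⇒~ px) (side-↑ˡ p) , E⇒end∈V i px , x∉
      ... | yes _  | no y∉ = y , ~true (—⇒~ qy) (side-↑ˡ q) , E⇒end∈V i qy , y∉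
      ... | yes x∈ | yes y∈
        with jx , jx∈ , refl ← right∈ (~true (—⇒~ px) (side-↑ˡ p)) x∈
           | jy , jy∈ , refl ← right∈ (~true (—⇒~ qy) (side-↑ˡ q)) y∈
        with rainbow i px qy (trans (mono px (inj₁ refl) jx∈) (sym (mono qy (inj₂ refl) jy∈)))
      ...   | inj₁ (eq , _) = ⊥-elim (lp≢lq eq)
      ...   | inj₂ (eq , _) = ⊥-elim (left≢right (side-↑ˡ p) (side-↑ʳ jy) eq)
      left-outsider : (∃[ x ] right j₁ — x) → (∃[ y ] right j₂ — y) → Outsider true
      left-outsider (x , e) (y , f) with x ∈xs? | y ∈xs?
      ... | no x∉  | _     = x , ~false (—⇒~ e) (side-↑ʳ j₁) , E⇒end∈V i e , x∉
      ... | yes _  | no y∉ = y , ~false (—⇒~ f) (side-↑ʳ j₂) , E⇒end∈V i f , y∉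
      ... | yes x∈ | yes y∈
        with sx ← ~false (—⇒~ e) (side-↑ʳ j₁) | sy ← ~false (—⇒~ f) (side-↑ʳ j₂)
        with rainbow i (—-sym e) (—-sym f)
               (trans (mono (—-sym e) (left∈ sx x∈) (Any.here refl))
                 (sym (mono (—-sym f) (left∈ sy y∈) (Any.there (Any.here refl)))))
      ...   | inj₁ (_ , eq) = ⊥-elim (rj≢ eq)
      ...   | inj₂ (eq , _) = ⊥-elim (left≢right sx (side-↑ʳ j₂) eq)
      absurd : (∃[ x ] left p — x) → (∃[ x ] left q — x) → (∃[ x ] right j₁ — x) → (∃[ x ] right j₂ — x) → ⊥
      absurd a b c d with right-outsider a b | left-outsider c d
      ... | x , x-right , x∈ , x∉ | y , y-left , y∈ , y∉ =
        left≢right y-left x-right (one-outsider i t≤k y∈ y∉ x∈ x∉)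

-- Both bounds combined

double-star-colouring : ∀ {m n k ℓ} → 0 < k → UniversalColouring m n (suc k) (suc k) ℓ →
                        Σ (EdgeColouring (K m n) (suc k)) (IsRainbowColouring k ℓ)
double-star-colouring {m} {n} {k} 0<k UC = Bipartite.colouring m n cc cc-sym , λ S ∣S∣≡k →
  let enum = subst (Enumeration S) ∣S∣≡k (enumerate S) in
  RainbowTrees.double-stars UC S enum (n≤1+n k) (fromℕ k) fresh (Enumeration.at enum (fromℕ< 0<k))
  where
  open UniversalColouring UC
  -- The terminals use the first `k` colours; the last one is kept for the edge between the two
  -- centres.
  fresh : ∀ i → inject≤ i (n≤1+n k) ≢ fromℕ k
  fresh i eq = <-irrefl
    (trans (sym (toℕ-inject≤ i (n≤1+n k))) (trans (cong toℕ eq) (toℕ-fromℕ k))) (toℕ<n i)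

three-colouring : ∀ {m n ℓ} → ℓ ≡ 1 ⊎ ℓ ≡ 2 → UniversalColouring m n 3 4 ℓ →
                  Σ (EdgeColouring (K m n) 3) (IsRainbowColouring 3 ℓ)
three-colouring {m} {n} {ℓ} ℓ≤2 UC = Bipartite.colouring m n cc cc-sym , λ S ∣S∣≡3 →
  ThreeColours.trees UC S (subst (Enumeration S) ∣S∣≡3 (enumerate S))
    (proj₁ (choose ℓ≤2)) (λ {i} {j} → proj₂ (choose ℓ≤2) i j)
  where
  open UniversalColouring UC
  choose : ∀ {ℓ} → ℓ ≡ 1 ⊎ ℓ ≡ 2 → Σ (Fin ℓ → Bool) λ f → ∀ i j → f i ≡ f j → i ≡ j
  choose (inj₁ refl) = (λ _ → true) , λ { zero zero _ → refl }
  choose (inj₂ refl) = (λ { zero → true ; (suc zero) → false })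
    , λ { zero zero _ → refl ; zero (suc zero) () ; (suc zero) zero () ; (suc zero) (suc zero) _ → refl }

lower-bound-k : ∀ {m n ℓ t k} → 4 ≤ k → suc k ≤ m → suc k * (suc k * k) * k < n → 0 < ℓ →
                Σ (EdgeColouring (K m n) t) (IsRainbowColouring k ℓ) → suc k ≤ t
lower-bound-k {m} {n} {t = t} {k} (s≤s (s≤s (s≤s (s≤s {n = b} z≤n)))) k<m big 0<ℓ (c , trees) = ≰⇒> λ t≤k →
  LowerBounds.k-colours m n c b k<m (≤-<-trans (small t≤k) big) 0<ℓ t≤k trees
  where
  -- The threshold has `k` in place of both `t` and `2 + b`, which makes it independent of the
  -- colouring.
  small : t ≤ k → suc k * (suc k * t) * (2 + b) ≤ suc k * (suc k * k) * k
  small t≤k = *-mono-≤ (*-monoʳ-≤ (suc k) (*-monoʳ-≤ (suc k) t≤k)) (m≤n+m (2 + b) 2)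

corollary2p5 : ∀ (C α : ℝ) → 0ℚ ℚ<ℝ C → 1ℚ ℚ≤ℝ α →
    ∀ (k ℓ : ℕ) → 3 ≤ k → 0 < ℓ →
    ∃[ N ] (0 < N ×
    (∀ (m n : ℕ) → 0 < m → 0 < n → n ≤ m → m ≤ C · n ^ℝ α → N ≤ n →
    (k ≡ 3 → ℓ ≡ 1 ⊎ ℓ ≡ 2 → rx[ k , ℓ ] (K m n) is 3)
    × (k ≡ 3 → 3 ≤ ℓ → rx[ k , ℓ ] (K m n) is 4)
    × (4 ≤ k → rx[ k , ℓ ] (K m n) is (k + 1))))
corollary2p5 C α 0<C 1≤α k@(suc _) ℓ@(suc _) 3≤k 0<ℓ =
  N , s≤s z≤n , λ m n _ _ n≤m m≤ N≤n → bounds m n n≤m (m≤A*n^p m n m≤) N≤n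
  where
  A p : ℕ
  A = proj₁ (polynomial-bound C α 0<C 1≤α)
  p = proj₁ (proj₂ (polynomial-bound C α 0<C 1≤α))
  m≤A*n^p = proj₂ (proj₂ (polynomial-bound C α 0<C 1≤α))
  -- In both colourings `κ` counts the terminals and the one extra vertex of a centre.
  three = universal-colouring A p 3 ℓ 4
  general = universal-colouring A p (suc k) ℓ (suc k)
  mono N : ℕ
  mono = suc k * (suc k * k) * k
  -- The sum exceeds every single threshold, and the outer `suc` makes the inequality for `mono`
  -- strict.
  N = suc (mono + suc k + (proj₁ three + proj₁ general))
  bounds : ∀ m n → n ≤ m → m ≤ A * n ^ p → N ≤ n →
    (k ≡ 3 → ℓ ≡ 1 ⊎ ℓ ≡ 2 → rx[ k , ℓ ] (K m n) is 3)
    × (k ≡ 3 → 3 ≤ ℓ → rx[ k , ℓ ] (K m n) is 4)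
    × (4 ≤ k → rx[ k , ℓ ] (K m n) is (k + 1))
  bounds m n n≤m m≤ N≤n =
      (λ { refl ℓ≤2 → three-colouring ℓ≤2 UC₃
         , λ t (c , trees) → ≰⇒> λ t≤2 → LowerBounds.two-colours m n c 3≤m 0<ℓ t≤2 trees })
    , (λ { refl 3≤ℓ → double-star-colouring (s≤s z≤n) UC
         , λ t (c , trees) → ≰⇒> λ t≤3 → LowerBounds.three-colours m n c (≤-trans (n≤1+n 2) 3≤m) 1≤n 3≤ℓ t≤3 trees })
    , λ 4≤k → subst (rx[ k , ℓ ] (K m n) is_) (+-comm 1 k)
        (double-star-colouring (s≤s z≤n) UC
        , λ t admits → lower-bound-k 4≤k (≤-trans k<n n≤m) mono<n 0<ℓ admits)
    where
    mono<n : mono < n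
    mono<n = ≤-trans (s≤s (≤-trans (m≤m+n mono (suc k)) (m≤m+n _ _))) N≤n
    k<n : suc k ≤ n
    k<n = ≤-trans (≤-trans (m≤n+m (suc k) mono) (≤-trans (m≤m+n _ _) (n≤1+n _))) N≤n
    1≤n = ≤-trans (s≤s z≤n) k<n
    3≤m = ≤-trans 3≤k (≤-trans (n≤1+n k) (≤-trans k<n n≤m))
    colourings≤n : proj₁ three + proj₁ general ≤ n
    colourings≤n = ≤-trans (≤-trans (m≤n+m _ (mono + suc k)) (n≤1+n _)) N≤n
    UC₃ : UniversalColouring m n 3 4 ℓ
    UC₃ = proj₂ three m n n≤m m≤ (≤-trans (m≤m+n _ _) colourings≤n)
    UC : UniversalColouring m n (suc k) (suc k) ℓ
    UC = proj₂ general m n n≤m m≤ (≤-trans (m≤n+m _ (proj₁ three)) colourings≤n)
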